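{- Let $\mathcal{H}_2$ be the class of $2$-vertex extremal minimal bipartite matching covered graphs and $\mathcal{H}_4$ the class of edge extremal minimal bipartite matching covered graphs. Then $\mathcal{H}_4-C_6\subset\mathcal{H}_2$ (a proper containment).
   Context: All graphs are finite and loopless; parallel edges are allowed. For a graph $G=(V,E)$ write $n=|V|$ and $m=|E|$. A connected graph on four or more vertices is matching covered if every edge lies in some perfect matching. A matching covered graph is minimal if deleting any single edge yields a graph that is not matching covered. $V_2$ is the set of vertices of degree two. A minimal bipartite matching covered graph is $2$-vertex extremal if $|V_2|=2(m-n+2)$, and edge extremal if $|E|=\frac{3n-6}{2}$. $\mathcal{H}_4-C_6$ denotes the class $\mathcal{H}_4$ with the $6$-cycle $C_6$ removed. Classes are regarded up to isomorphism. -}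

module Defs where

open import Data.Bool using (Bool)
open import Data.Fin using (Fin; toℕ; punchIn)
open import Data.Fin.Permutation using (Permutation; _⟨$⟩ʳ_)
open import Data.Fin.Properties using (_≟_; all?)
open import Data.Fin.Subset using (Subset) renaming (_∈_ to _∈ₛ_)
open import Data.Integer as ℤ using (+_)
open import Data.List using (List; length; filter; allFin)
open import Data.Nat as ℕ using (ℕ; suc; _≤_)
open import Data.Nat.DivMod using (_mod_)
open import Data.Product using (_×_; _,_; proj₁; proj₂; ∃; ∃!)
open import Data.Sum using (_⊎_)
open import Function using (_∘_)
open import Relation.Binary.Construct.Closure.ReflexiveTransitive using (Star)
open import Relation.Binary.PropositionalEquality using (_≡_; _≢_)
open import Relation.Nullary using (¬_; Dec; ¬?; _⊎-dec_)
open import Relation.Nullary.Decidable using (from-yes)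
open import Relation.Unary using (Pred)
open import Level using (0ℓ)

-- Edges carry their own names, so parallel edges are allowed.  The order of
-- the two ends of an edge has no meaning: every notion below ignores it.
record Graph : Set where
  constructor graph
  field
    order    : ℕ
    size     : ℕ
    ends     : Fin size → Fin order × Fin order
    loopless : ∀ e → proj₁ (ends e) ≢ proj₂ (ends e)

  Vertex Edge : Set
  Vertex = Fin order
  Edge   = Fin size

  Joins : Edge → Vertex → Vertex → Set
  Joins e u v = ends e ≡ (u , v) ⊎ ends e ≡ (v , u)

  Adjacent : Vertex → Vertex → Set
  Adjacent u v = ∃ λ e → Joins e u v

  Incident : Vertex → Edge → Set
  Incident v e = v ≡ proj₁ (ends e) ⊎ v ≡ proj₂ (ends e)

  incident? : ∀ v e → Dec (Incident v e)
  incident? v e = (v ≟ proj₁ (ends e)) ⊎-dec (v ≟ proj₂ (ends e))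

  degree : Vertex → ℕ
  degree v = length (filter (incident? v) (allFin size))

  V₂ : List Vertex
  V₂ = filter (λ v → degree v ℕ.≟ 2) (allFin order)

open Graph

record _≅_ (G H : Graph) : Set where
  field
    onVertices : Permutation (order G) (order H)
    onEdges    : Permutation (size G) (size H)
    preserves  : ∀ e u v → Joins G e u v →
                 Joins H (onEdges ⟨$⟩ʳ e) (onVertices ⟨$⟩ʳ u) (onVertices ⟨$⟩ʳ v)

infix 4 _≅_

-- Deletes one edge and keeps all vertices; the remaining edges are renumbered.
_-ₑ_ : (G : Graph) → Edge G → Graph
graph n (suc m) ends loopless -ₑ e = graph n m (ends ∘ punchIn e) (loopless ∘ punchIn e)

Connected : Pred Graph 0ℓ
Connected G = ∀ u v → Star (Adjacent G) u v

Bipartite : Pred Graph 0ℓ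
Bipartite G = ∃ λ (side : Vertex G → Bool) →
  ∀ e → side (proj₁ (ends G e)) ≢ side (proj₂ (ends G e))

PerfectMatching : (G : Graph) → Pred (Subset (size G)) 0ℓ
PerfectMatching G M = ∀ v → ∃! _≡_ λ e → e ∈ₛ M × Incident G v e

MatchingCovered : Pred Graph 0ℓ
MatchingCovered G = 4 ≤ order G × Connected G ×
  (∀ e → ∃ λ M → PerfectMatching G M × e ∈ₛ M)

MinimalMatchingCovered : Pred Graph 0ℓ
MinimalMatchingCovered G = MatchingCovered G × (∀ e → ¬ MatchingCovered (G -ₑ e))

MinimalBipartiteMatchingCovered : Pred Graph 0ℓ
MinimalBipartiteMatchingCovered G = Bipartite G × MinimalMatchingCovered G

-- The two extremality equations are stated over ℤ, so that subtraction is not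
-- truncated.

TwoVertexExtremal : Pred Graph 0ℓ
TwoVertexExtremal G =
  + length (V₂ G) ≡ + 2 ℤ.* (+ size G ℤ.- + order G ℤ.+ + 2)

-- |E| = (3n - 6)/2 with the denominator cleared.
EdgeExtremal : Pred Graph 0ℓ
EdgeExtremal G = + 2 ℤ.* + size G ≡ + 3 ℤ.* + order G ℤ.- + 6

H₂ : Pred Graph 0ℓ
H₂ G = MinimalBipartiteMatchingCovered G × TwoVertexExtremal G

H₄ : Pred Graph 0ℓ
H₄ G = MinimalBipartiteMatchingCovered G × EdgeExtremal G

C₆ : Graph
C₆ = graph 6 6 ends₆ (from-yes (all? λ e → ¬? (proj₁ (ends₆ e) ≟ proj₂ (ends₆ e))))
  where
  ends₆ : Fin 6 → Fin 6 × Fin 6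
  ends₆ i = i , suc (toℕ i) mod 6

{-# OPTIONS --safe #-}
-- Delete an edge e = ab from a minimal bipartite matching covered graph with
-- colour classes A ∋ a and B ∋ b.  By Hall's theorem there is then a set Q ⊆ B
-- containing b, with |N(Q)| = |Q| + 1, such that e is the only edge from a to Q.
-- These sets are closed under union; call the greatest one the branch of e.
-- Submodularity of |N(Q)| gives that
--   * if deg a ≥ 3, the neighbourhoods of the branches at a meet only in a;
--   * if deg b ≥ 3, two branches at b cover B;
-- hence, if deg a ≥ 3 and e, f are two edges at a, the branch of e is properly
-- contained in the branch of every other edge g at the B-end of f.
--
-- Let each vertex of A choose an incident edge with the largest branch.  By the
-- nesting, the B-ends of the remaining edges at vertices of A of degree ≥ 3 are
-- distinct, and they avoid at least two vertices of B.  Counting edges gives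
-- m ≤ 3n/2 − 2 − s if s ≥ 1 vertices of A have degree ≥ 3, so an edge extremal
-- graph has s ≤ 1, and likewise for B.  If s = 0 then n = m = 6 and the graph is
-- C₆; otherwise exactly n − 2 = 2(m − n + 2) vertices have degree two.  The
-- inclusion is proper because of C₄.
module Submission where

open import Defs
open import Data.Bool using (Bool; true; false; not)
import Data.Bool.Properties as Bool
import Data.Empty as Empty
open import Data.Fin using (Fin; zero; suc; toℕ; fromℕ<; punchIn; punchOut)
open import Data.Fin.Patterns
open import Data.Fin.Permutation using (Permutation; permutation)
open import Data.Fin.Properties as Fin
  using (_≟_; any?; all?; punchIn-punchOut; punchInᵢ≢i; punchIn-injective)
open import Data.Fin.Subset
  using ( Subset; _⊂_; _⊃_; ∣_∣; ⊤; ⊥; ⁅_⁆; _∪_; _∩_; _─_; _-_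
        ; Nonempty; Empty; inside; outside)
  renaming (_∈_ to _∈ₛ_; _∉_ to _∉ₛ_; _⊆_ to _⊆ₛ_)
open import Data.Fin.Subset.Induction using (⊂-wellFounded; ⊃-wellFounded; Acc; acc)
open import Data.Fin.Subset.Properties
import Data.Integer as ℤ
import Data.Integer.Properties as ℤ
import Data.Integer.Solver as ℤ
open import Data.List as List using (length; filter; allFin)
open import Data.Nat as ℕ using (ℕ; zero; suc; _+_; _*_; _≤_; _<_; z≤n; s≤s; s≤s⁻¹)
open import Data.Nat.DivMod using (_mod_)
open import Data.Nat.Induction using (<-wellFounded)
open import Data.Nat.Properties hiding (_≟_; suc-injective; 0≢1+n)
import Data.Nat.Solver as ℕ
open import Data.Product using (_×_; _,_; proj₁; proj₂; ∃; swap)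
open import Data.Product.Properties using (≡-dec)
open import Data.Sum using (_⊎_; inj₁; inj₂)
import Data.Sum.Properties as Sum
open import Data.Vec using ([]; _∷_; tabulate; here; there)
open import Data.Vec.Properties using (lookup∘tabulate; []=⇒lookup; lookup⇒[]=)
open import Function using (_∘_)
open import Level using (0ℓ)
open import Relation.Binary.Construct.Closure.ReflexiveTransitive as Star using (Star; ε; _◅_; _◅◅_)
open import Relation.Binary.PropositionalEquality
open import Relation.Nullary
open import Relation.Nullary.Decidable using (dec-true; decidable-stable; from-yes; map′)
open import Relation.Unary using (Pred; Decidable; _∈_; _∉_; _⊆_; _∖_)

open Graph

private
  variable
    m n : ℕ

-- Finite subsets
module _ {P : Pred (Fin n) 0ℓ} (P? : Decidable P) where

  subset : Subset n
  subset = tabulate (does ∘ P?)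

  ∈-subset⁺ : ∀ {x} → P x → x ∈ₛ subset
  ∈-subset⁺ {x} px = lookup⇒[]= x _ (trans (lookup∘tabulate _ x) (dec-true (P? x) px))

  ∈-subset⁻ : ∀ {x} → x ∈ₛ subset → P x
  ∈-subset⁻ {x} x∈ with P? x in eq
  ... | yes px = px
  ... | no _   with () ← trans (sym (trans (lookup∘tabulate (does ∘ P?) x) (cong does eq))) ([]=⇒lookup x∈)

∣∪∣+∣∩∣ : (p q : Subset n) → ∣ p ∪ q ∣ + ∣ p ∩ q ∣ ≡ ∣ p ∣ + ∣ q ∣
∣∪∣+∣∩∣ []            []            = refl
∣∪∣+∣∩∣ (outside ∷ p) (outside ∷ q) = ∣∪∣+∣∩∣ p q
∣∪∣+∣∩∣ (outside ∷ p) (inside  ∷ q) = trans (cong suc (∣∪∣+∣∩∣ p q)) (sym (+-suc ∣ p ∣ ∣ q ∣))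
∣∪∣+∣∩∣ (inside  ∷ p) (outside ∷ q) = cong suc (∣∪∣+∣∩∣ p q)
∣∪∣+∣∩∣ (inside  ∷ p) (inside  ∷ q) = cong suc (begin-equality
  ∣ p ∪ q ∣ + suc ∣ p ∩ q ∣   ≡⟨ +-suc _ _ ⟩
  suc (∣ p ∪ q ∣ + ∣ p ∩ q ∣) ≡⟨ cong suc (∣∪∣+∣∩∣ p q) ⟩
  suc (∣ p ∣ + ∣ q ∣)         ≡⟨ +-suc _ _ ⟨
  ∣ p ∣ + suc ∣ q ∣           ∎)
  where open ≤-Reasoning

x∈p─q⇒x∉q : ∀ (p q : Subset n) {x} → x ∈ₛ p ─ q → x ∉ₛ q
x∈p─q⇒x∉q (_ ∷ p) (inside  ∷ q) (there x∈) (there x∈q) = x∈p─q⇒x∉q p q x∈ x∈q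
x∈p─q⇒x∉q (_ ∷ p) (outside ∷ q) (there x∈) (there x∈q) = x∈p─q⇒x∉q p q x∈ x∈q

module _ (p : Subset n) where

  x∈p-y⇒x∈p : ∀ {x y} → x ∈ₛ p - y → x ∈ₛ p
  x∈p-y⇒x∈p = p─q⊆p p _

  x∈p-y⇒x≢y : ∀ {x y} → x ∈ₛ p - y → x ≢ y
  x∈p-y⇒x≢y x∈ refl = x∈p─q⇒x∉q p _ x∈ (x∈⁅x⁆ _)

  ∣p∣≤1+∣p-x∣ : ∀ x → ∣ p ∣ ≤ suc ∣ p - x ∣
  ∣p∣≤1+∣p-x∣ x = begin
    ∣ p ∣                                      ≤⟨ p⊆q⇒∣p∣≤∣q∣ p⊆ ⟩
    ∣ ⁅ x ⁆ ∪ (p - x) ∣                        ≤⟨ m≤m+n _ _ ⟩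
    ∣ ⁅ x ⁆ ∪ (p - x) ∣ + ∣ ⁅ x ⁆ ∩ (p - x) ∣  ≡⟨ ∣∪∣+∣∩∣ ⁅ x ⁆ (p - x) ⟩
    ∣ ⁅ x ⁆ ∣ + ∣ p - x ∣                      ≡⟨ cong (_+ ∣ p - x ∣) (∣⁅x⁆∣≡1 x) ⟩
    suc ∣ p - x ∣                              ∎
    where
    open ≤-Reasoning
    p⊆ : p ⊆ₛ ⁅ x ⁆ ∪ (p - x)
    p⊆ {y} y∈p with y ≟ x
    ... | yes refl = x∈p∪q⁺ (inj₁ (x∈⁅x⁆ x))
    ... | no  y≢x  = x∈p∪q⁺ (inj₂ (x∈p∧x≢y⇒x∈p-y y∈p y≢x))

  x∈p⇒1+∣p-x∣≡∣p∣ : ∀ {x} → x ∈ₛ p → suc ∣ p - x ∣ ≡ ∣ p ∣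
  x∈p⇒1+∣p-x∣≡∣p∣ {x} x∈p = ≤-antisym (x∈p⇒∣p-x∣<∣p∣ x∈p) (∣p∣≤1+∣p-x∣ x)

  0<∣p∣⇒Nonempty : 0 < ∣ p ∣ → Nonempty p
  0<∣p∣⇒Nonempty 0<∣p∣ with nonempty? p
  ... | yes ne = ne
  ... | no  ¬ne with refl ← Empty-unique ¬ne = contradiction (∣⊥∣≡0 n) (>⇒≢ 0<∣p∣)

x∈p⇒0<∣p∣ : {p : Subset n} {x : Fin n} → x ∈ₛ p → 0 < ∣ p ∣
x∈p⇒0<∣p∣ x∈p = ≤-trans (s≤s z≤n) (x∈p⇒∣p-x∣<∣p∣ x∈p)

1<∣p∣⇒another : (p : Subset n) → 1 < ∣ p ∣ → ∀ x → ∃ λ y → y ∈ₛ p × y ≢ x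
1<∣p∣⇒another p 1<∣p∣ x
  with y , y∈ ← 0<∣p∣⇒Nonempty (p - x) (s≤s⁻¹ (≤-trans 1<∣p∣ (∣p∣≤1+∣p-x∣ p x)))
  = y , x∈p-y⇒x∈p p y∈ , x∈p-y⇒x≢y p y∈

2<∣p∣⇒another : (p : Subset n) → 2 < ∣ p ∣ → ∀ x y → ∃ λ z → z ∈ₛ p × z ≢ x × z ≢ y
2<∣p∣⇒another p 2<∣p∣ x y
  with z , z∈ , z≢y ← 1<∣p∣⇒another (p - x) (s≤s⁻¹ (≤-trans 2<∣p∣ (∣p∣≤1+∣p-x∣ p x))) y
  = z , x∈p-y⇒x∈p p z∈ , x∈p-y⇒x≢y p z∈ , z≢y

distinct₂⇒1<∣p∣ : {p : Subset n} {x y : Fin n} → x ∈ₛ p → y ∈ₛ p → x ≢ y → 1 < ∣ p ∣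
distinct₂⇒1<∣p∣ x∈p y∈p x≢y =
  ≤-trans (s≤s (x∈p⇒0<∣p∣ (x∈p∧x≢y⇒x∈p-y x∈p x≢y))) (x∈p⇒∣p-x∣<∣p∣ y∈p)

distinct₃⇒2<∣p∣ : {p : Subset n} {x y z : Fin n} → x ∈ₛ p → y ∈ₛ p → z ∈ₛ p →
                  x ≢ y → x ≢ z → y ≢ z → 2 < ∣ p ∣
distinct₃⇒2<∣p∣ x∈p y∈p z∈p x≢y x≢z y≢z =
  ≤-trans (s≤s (distinct₂⇒1<∣p∣ (x∈p∧x≢y⇒x∈p-y x∈p x≢z) (x∈p∧x≢y⇒x∈p-y y∈p y≢z) x≢y))
          (x∈p⇒∣p-x∣<∣p∣ z∈p)

-- Pigeonhole principle for subsets. Each image is removed from q as soon as it is used, so that the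
-- rest of p maps into what remains.
injectiveOn⇒∣p∣≤∣q∣ : (p : Subset m) {q : Subset n} (f : Fin m → Fin n) →
  (∀ {x} → x ∈ₛ p → f x ∈ₛ q) →
  (∀ {x y} → x ∈ₛ p → y ∈ₛ p → f x ≡ f y → x ≡ y) →
  ∣ p ∣ ≤ ∣ q ∣
injectiveOn⇒∣p∣≤∣q∣ [] f into inj = z≤n
injectiveOn⇒∣p∣≤∣q∣ (outside ∷ p) f into inj =
  injectiveOn⇒∣p∣≤∣q∣ p (f ∘ suc) (into ∘ there)
    (λ x∈ y∈ eq → Fin.suc-injective (inj (there x∈) (there y∈) eq))
injectiveOn⇒∣p∣≤∣q∣ (inside ∷ p) {q} f into inj =
  ≤-trans (s≤s (injectiveOn⇒∣p∣≤∣q∣ p {q - f zero} (f ∘ suc)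
    (λ x∈ → x∈p∧x≢y⇒x∈p-y (into (there x∈)) (λ eq → Fin.0≢1+n (sym (inj (there x∈) here eq))))
    (λ x∈ y∈ eq → Fin.suc-injective (inj (there x∈) (there y∈) eq))))
  (x∈p⇒∣p-x∣<∣p∣ (into here))


∣p∪⁅x⁆∣≤1+∣p∣ : ∀ (p : Subset n) x → ∣ p ∪ ⁅ x ⁆ ∣ ≤ suc ∣ p ∣
∣p∪⁅x⁆∣≤1+∣p∣ p x = begin
  ∣ p ∪ ⁅ x ⁆ ∣                    ≤⟨ m≤m+n _ _ ⟩
  ∣ p ∪ ⁅ x ⁆ ∣ + ∣ p ∩ ⁅ x ⁆ ∣    ≡⟨ ∣∪∣+∣∩∣ p ⁅ x ⁆ ⟩
  ∣ p ∣ + ∣ ⁅ x ⁆ ∣                ≡⟨ cong (∣ p ∣ +_) (∣⁅x⁆∣≡1 x) ⟩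
  ∣ p ∣ + 1                        ≡⟨ +-comm ∣ p ∣ 1 ⟩
  suc ∣ p ∣                        ∎
  where open ≤-Reasoning

-- Degrees and `V₂` are defined by filtering lists; this turns them into cardinalities of subsets.
-- `go` carries an arbitrary f because `allFin` is the tabulation of the identity.
length-filter-allFin : {P : Pred (Fin n) 0ℓ} (P? : Decidable P) →
                       length (filter P? (allFin n)) ≡ ∣ subset P? ∣
length-filter-allFin P? = go P? (λ i → i)
  where
  go : ∀ {n k} {P : Pred (Fin n) 0ℓ} (P? : Decidable P) (f : Fin k → Fin n) →
       length (filter P? (List.tabulate f)) ≡ ∣ subset (P? ∘ f) ∣
  go {k = zero}  P? f = refl
  go {k = suc k} P? f with P? (f zero)
  ... | yes _ = cong suc (go P? (f ∘ suc))
  ... | no  _ = go P? (f ∘ suc)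

minimum : {P : Pred (Fin n) 0ℓ} (P? : Decidable P) (φ : Fin n → ℕ) →
          ∃ P → ∃ λ i → P i × (∀ {j} → P j → φ i ≤ φ j)
minimum {P = P} P? φ (i , pi) = go i pi (<-wellFounded (φ i))
  where
  go : ∀ i → P i → Acc _<_ (φ i) → ∃ λ i → P i × (∀ {j} → P j → φ i ≤ φ j)
  go i pi (acc rec) with any? (λ j → P? j ×-dec φ j ℕ.<? φ i)
  ... | yes (j , pj , φj<φi) = go j pj (rec φj<φi)
  ... | no  none             = i , pi , λ {j} pj → ≮⇒≥ (λ φj<φi → none (j , pj , φj<φi))

x∈q∧x∉p⇒p⊂p∪q : {p q : Subset n} {x : Fin n} → x ∈ₛ q → x ∉ₛ p → p ⊂ p ∪ q
x∈q∧x∉p⇒p⊂p∪q {p = p} {q} x∈q x∉p = (λ {_} → p⊆p∪q q) , _ , q⊆p∪q p q x∈q , x∉p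

-- While some member is not contained in p, joining it to p gives a strictly larger member; the
-- climb ends because proper inclusion is well-founded.
∪-closed⇒greatest : {P : Pred (Subset n) 0ℓ} → Decidable P → ∃ P →
  (∀ {p q} → P p → P q → P (p ∪ q)) → ∃ λ p → P p × (∀ {q} → P q → q ⊆ₛ p)
∪-closed⇒greatest {P = P} P? (p , Pp) ∪-closed = go p Pp (⊃-wellFounded p)
  where
  go : ∀ p → P p → Acc _⊃_ p → ∃ λ p → P p × (∀ {q} → P q → q ⊆ₛ p)
  go p Pp (acc rec) with anySubset? (λ q → P? q ×-dec ¬? (q ⊆? p))
  ... | no none = p , Pp , λ {q} Pq → decidable-stable (q ⊆? p) (λ q⊈p → none (q , Pq , q⊈p))
  ... | yes (q , Pq , q⊈p) with any? (λ x → (x ∈? q) ×-dec ¬? (x ∈? p))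
  ...   | yes (x , x∈q , x∉p) =
            go (p ∪ q) (∪-closed Pp Pq) (rec (x∈q∧x∉p⇒p⊂p∪q x∈q x∉p))
  ...   | no none = contradiction
            (λ {x} x∈q → decidable-stable (x ∈? p) (λ x∉p → none (x , x∈q , x∉p))) q⊈p

-- Adds one missing successor at a time. The result replaces `Star` by a subset, which can be
-- intersected and counted.
reachableSet : {_⟶_ : Fin n → Fin n → Set} → (∀ x y → Dec (x ⟶ y)) → ∀ x →
  ∃ λ p → x ∈ₛ p × (∀ {y} → y ∈ₛ p → Star _⟶_ x y) × (∀ {y z} → y ∈ₛ p → y ⟶ z → z ∈ₛ p)
reachableSet {n} {_⟶_} _⟶?_ x =
  go ⁅ x ⁆ (x∈⁅x⁆ x) (λ y∈ → subst (Star _⟶_ x) (sym (x∈⁅y⁆⇒x≡y x y∈)) ε) (⊃-wellFounded ⁅ x ⁆)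
  where
  go : ∀ p → x ∈ₛ p → (∀ {y} → y ∈ₛ p → Star _⟶_ x y) → Acc _⊃_ p →
       ∃ λ p → x ∈ₛ p × (∀ {y} → y ∈ₛ p → Star _⟶_ x y) × (∀ {y z} → y ∈ₛ p → y ⟶ z → z ∈ₛ p)
  go p x∈p reach (acc rec) with any? (λ z → ¬? (z ∈? p) ×-dec any? (λ y → (y ∈? p) ×-dec (y ⟶? z)))
  ... | no none = p , x∈p , reach , λ {y} {z} y∈p y⟶z →
          decidable-stable (z ∈? p) (λ z∉p → none (z , z∉p , y , y∈p , y⟶z))
  ... | yes (z , z∉p , y , y∈p , y⟶z) =
          go (p ∪ ⁅ z ⁆) (p⊆p∪q ⁅ z ⁆ x∈p) reach′
             (rec (x∈q∧x∉p⇒p⊂p∪q (x∈⁅x⁆ z) z∉p))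
    where
    reach′ : ∀ {w} → w ∈ₛ p ∪ ⁅ z ⁆ → Star _⟶_ x w
    reach′ w∈ with x∈p∪q⁻ p ⁅ z ⁆ w∈
    ... | inj₁ w∈p = reach w∈p
    ... | inj₂ w∈z with refl ← x∈⁅y⁆⇒x≡y z w∈z = reach y∈p ◅◅ y⟶z ◅ ε

-- Hall's theorem in a bipartite graph

module Sided (G : Graph) (side : Vertex G → Bool)
             (bipartite : ∀ e → side (proj₁ (ends G e)) ≢ side (proj₂ (ends G e))) where

  private
    V E : Set
    V = Vertex G
    E = Edge G

    VertexSet EdgeSet : Set
    VertexSet = Subset (order G)
    EdgeSet   = Subset (size G)

  -- The stored order of the two ends is arbitrary, so every edge is directed afresh from the `true`
  -- side to the `false` side.
  orient : ∀ e → ∃ λ a → ∃ λ b → side a ≡ true × side b ≡ false × Joins G e a b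
  orient e with side (proj₁ (ends G e)) in p | side (proj₂ (ends G e)) in q
  ... | true  | true  = contradiction (trans p (sym q)) (bipartite e)
  ... | true  | false = _ , _ , p , q , inj₁ refl
  ... | false | true  = _ , _ , q , p , inj₂ refl
  ... | false | false = contradiction (trans p (sym q)) (bipartite e)

  α β : E → V
  α e = proj₁ (orient e)
  β e = proj₁ (proj₂ (orient e))

  onA? : ∀ v → Dec (side v ≡ true)
  onA? v = side v Bool.≟ true

  onB? : ∀ v → Dec (side v ≡ false)
  onB? v = side v Bool.≟ false

  A B : VertexSet
  A = subset onA?
  B = subset onB?

  A-∉-B : ∀ {v} → v ∈ₛ A → v ∉ₛ B
  A-∉-B v∈A v∈B with () ← trans (sym (∈-subset⁻ onA? v∈A)) (∈-subset⁻ onB? v∈B)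

  A⊎B : ∀ v → v ∈ₛ A ⊎ v ∈ₛ B
  A⊎B v with side v in eq
  ... | true  = inj₁ (∈-subset⁺ onA? eq)
  ... | false = inj₂ (∈-subset⁺ onB? eq)

  α∈A : ∀ e → α e ∈ₛ A
  α∈A e = ∈-subset⁺ onA? (proj₁ (proj₂ (proj₂ (orient e))))

  β∈B : ∀ e → β e ∈ₛ B
  β∈B e = ∈-subset⁺ onB? (proj₁ (proj₂ (proj₂ (proj₂ (orient e)))))

  joins : ∀ e → Joins G e (α e) (β e)
  joins e = proj₂ (proj₂ (proj₂ (proj₂ (orient e))))

  ∣A∣+∣B∣≡n : ∣ A ∣ + ∣ B ∣ ≡ order G
  ∣A∣+∣B∣≡n = begin
    ∣ A ∣ + ∣ B ∣         ≡⟨ ∣∪∣+∣∩∣ A B ⟨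
    ∣ A ∪ B ∣ + ∣ A ∩ B ∣ ≡⟨ cong₂ (λ p q → ∣ p ∣ + ∣ q ∣) A∪B≡⊤ A∩B≡⊥ ⟩
    ∣ ⊤ {order G} ∣ + ∣ ⊥ {order G} ∣ ≡⟨ cong₂ _+_ (∣⊤∣≡n (order G)) (∣⊥∣≡0 (order G)) ⟩
    order G + 0           ≡⟨ +-identityʳ _ ⟩
    order G               ∎
    where
    open ≡-Reasoning
    A∪B≡⊤ : A ∪ B ≡ ⊤
    A∪B≡⊤ = ⊆-antisym ⊆⊤ (λ {v} _ → x∈p∪q⁺ (A⊎B v))
    A∩B≡⊥ : A ∩ B ≡ ⊥
    A∩B≡⊥ = Empty-unique λ (v , v∈) → let v∈A , v∈B = x∈p∩q⁻ A B v∈ in A-∉-B v∈A v∈B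

  incident-α : ∀ e → Incident G (α e) e
  incident-α e with joins e
  ... | inj₁ eq = inj₁ (sym (cong proj₁ eq))
  ... | inj₂ eq = inj₂ (sym (cong proj₂ eq))

  incident-β : ∀ e → Incident G (β e) e
  incident-β e with joins e
  ... | inj₁ eq = inj₂ (sym (cong proj₂ eq))
  ... | inj₂ eq = inj₁ (sym (cong proj₁ eq))

  incident⇒α⊎β : ∀ {v e} → Incident G v e → v ≡ α e ⊎ v ≡ β e
  incident⇒α⊎β {e = e} v~e with v~e | joins e
  ... | inj₁ refl | inj₁ eq = inj₁ (cong proj₁ eq)
  ... | inj₁ refl | inj₂ eq = inj₂ (cong proj₁ eq)
  ... | inj₂ refl | inj₁ eq = inj₂ (cong proj₂ eq)
  ... | inj₂ refl | inj₂ eq = inj₁ (cong proj₂ eq)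

  incident-A : ∀ {v e} → v ∈ₛ A → Incident G v e → v ≡ α e
  incident-A {e = e} v∈A v~e with incident⇒α⊎β v~e
  ... | inj₁ v≡α = v≡α
  ... | inj₂ refl = contradiction (β∈B e) (A-∉-B v∈A)

  incident-B : ∀ {v e} → v ∈ₛ B → Incident G v e → v ≡ β e
  incident-B {e = e} v∈B v~e with incident⇒α⊎β v~e
  ... | inj₁ refl = contradiction v∈B (A-∉-B (α∈A e))
  ... | inj₂ v≡β = v≡β

  joins⇒ : ∀ {u v e} → Joins G e u v → u ≡ α e × v ≡ β e ⊎ u ≡ β e × v ≡ α e
  joins⇒ {e = e} j with j | joins e
  ... | inj₁ p | inj₁ q = inj₁ (cong proj₁ (trans (sym p) q) , cong proj₂ (trans (sym p) q))
  ... | inj₁ p | inj₂ q = inj₂ (cong proj₁ (trans (sym p) q) , cong proj₂ (trans (sym p) q))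
  ... | inj₂ p | inj₁ q = inj₂ (cong proj₂ (trans (sym p) q) , cong proj₁ (trans (sym p) q))
  ... | inj₂ p | inj₂ q = inj₁ (cong proj₂ (trans (sym p) q) , cong proj₁ (trans (sym p) q))

  joins-sym : ∀ {u v e} → Joins G e u v → Joins G e v u
  joins-sym (inj₁ p) = inj₂ p
  joins-sym (inj₂ p) = inj₁ p

  -- Perfect matchings as bijections between the colour classes

  module Matching {M : EdgeSet} (pm : PerfectMatching G M) where

    μ : V → E
    μ v = proj₁ (pm v)

    μ∈M : ∀ v → μ v ∈ₛ M
    μ∈M v = proj₁ (proj₁ (proj₂ (pm v)))

    μ-incident : ∀ v → Incident G v (μ v)
    μ-incident v = proj₂ (proj₁ (proj₂ (pm v)))

    μ-unique : ∀ {v e} → e ∈ₛ M → Incident G v e → μ v ≡ e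
    μ-unique e∈M v~e = proj₂ (proj₂ (pm _)) (e∈M , v~e)

    α-μ : ∀ {v} → v ∈ₛ A → α (μ v) ≡ v
    α-μ v∈A = sym (incident-A v∈A (μ-incident _))

    β-μ : ∀ {v} → v ∈ₛ B → β (μ v) ≡ v
    β-μ v∈B = sym (incident-B v∈B (μ-incident _))

    same-α : ∀ {e f} → e ∈ₛ M → f ∈ₛ M → α e ≡ α f → e ≡ f
    same-α {e} {f} e∈M f∈M eq =
      trans (sym (μ-unique e∈M (incident-α e)))
            (μ-unique f∈M (subst (λ v → Incident G v f) (sym eq) (incident-α f)))

    same-β : ∀ {e f} → e ∈ₛ M → f ∈ₛ M → β e ≡ β f → e ≡ f
    same-β {e} {f} e∈M f∈M eq =
      trans (sym (μ-unique e∈M (incident-β e)))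
            (μ-unique f∈M (subst (λ v → Incident G v f) (sym eq) (incident-β f)))

    α∘μ-injective : ∀ {b c} → b ∈ₛ B → c ∈ₛ B → α (μ b) ≡ α (μ c) → b ≡ c
    α∘μ-injective b∈B c∈B eq =
      trans (sym (β-μ b∈B)) (trans (cong β (same-α (μ∈M _) (μ∈M _) eq)) (β-μ c∈B))

    β∘μ-injective : ∀ {b c} → b ∈ₛ A → c ∈ₛ A → β (μ b) ≡ β (μ c) → b ≡ c
    β∘μ-injective b∈A c∈A eq =
      trans (sym (α-μ b∈A)) (trans (cong α (same-β (μ∈M _) (μ∈M _) eq)) (α-μ c∈A))

    ∣A∣≡∣B∣ : ∣ A ∣ ≡ ∣ B ∣
    ∣A∣≡∣B∣ = ≤-antisym
      (injectiveOn⇒∣p∣≤∣q∣ A (β ∘ μ) (λ _ → β∈B _) β∘μ-injective)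
      (injectiveOn⇒∣p∣≤∣q∣ B (α ∘ μ) (λ _ → α∈A _) α∘μ-injective)

  -- Neighbourhoods and Hall's condition

  module _ (K : EdgeSet) (Q : VertexSet) where

    private
      inN? : ∀ v → Dec (∃ λ e → e ∈ₛ K × α e ≡ v × β e ∈ₛ Q)
      inN? v = any? λ e → (e ∈? K) ×-dec (α e ≟ v) ×-dec (β e ∈? Q)

    -- The neighbours of Q in A along edges of K. With the edge set as a parameter, edges can be
    -- deleted without passing to another graph.
    N : VertexSet
    N = subset inN?

    ∈-N⁺ : ∀ {e} → e ∈ₛ K → β e ∈ₛ Q → α e ∈ₛ N
    ∈-N⁺ e∈K βe∈Q = ∈-subset⁺ inN? (_ , e∈K , refl , βe∈Q)

    ∈-N⁻ : ∀ {v} → v ∈ₛ N → ∃ λ e → e ∈ₛ K × α e ≡ v × β e ∈ₛ Q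
    ∈-N⁻ = ∈-subset⁻ inN?

    N⊆ : ∀ {p} → (∀ {e} → e ∈ₛ K → β e ∈ₛ Q → α e ∈ₛ p) → N ⊆ₛ p
    N⊆ h v∈ with _ , e∈K , refl , βe∈Q ← ∈-N⁻ v∈ = h e∈K βe∈Q

    N⊆A : N ⊆ₛ A
    N⊆A = N⊆ (λ _ _ → α∈A _)

  Proper : VertexSet → Set
  Proper Q = Q ⊆ₛ B × Nonempty Q × ∃ λ b → b ∈ₛ B × b ∉ₛ Q

  -- When |A| = |B|, `Hall` yields a perfect matching inside K, and `Surplus` yields one through
  -- each edge of K. Strictness is asked of proper subsets only, since N(B) lies in A.
  Surplus Hall : EdgeSet → Set
  Surplus K = ∀ {Q} → Proper Q → ∣ Q ∣ < ∣ N K Q ∣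
  Hall K = ∀ {Q} → Q ⊆ₛ B → ∣ Q ∣ ≤ ∣ N K Q ∣

  hallViolator? : ∀ K → Dec (∃ λ Q → Q ⊆ₛ B × ∣ N K Q ∣ < ∣ Q ∣)
  hallViolator? K = anySubset? λ Q → (Q ⊆? B) ×-dec (∣ N K Q ∣ ℕ.<? ∣ Q ∣)

  -- The step of Rado's proof of Hall's theorem.
  hall-deletion : ∀ {K e f} → Hall K → e ≢ f → β e ≡ β f → Hall (K - e) ⊎ Hall (K - f)
  hall-deletion {K} {e} {f} hall e≢f βe≡βf with hallViolator? (K - e) | hallViolator? (K - f)
  ... | no none | _ = inj₁ λ {Q} Q⊆B → ≮⇒≥ λ lt → none (Q , (λ {_} → Q⊆B) , lt)
  ... | yes _ | no none = inj₂ λ {Q} Q⊆B → ≮⇒≥ λ lt → none (Q , (λ {_} → Q⊆B) , lt)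
  ... | yes (P , P⊆B , P<) | yes (Q , Q⊆B , Q<) = contradiction bound (<⇒≱ (n<1+n _))
    where
    open ≤-Reasoning
    b : V
    b = β e

    -- A violator for K - g contains the B-end of g; otherwise deleting g would not change its
    -- neighbourhood.
    b∈ : ∀ {g R} → R ⊆ₛ B → ∣ N (K - g) R ∣ < ∣ R ∣ → β g ∈ₛ R
    b∈ {g} {R} R⊆B lt = decidable-stable (β g ∈? R) λ βg∉R → <⇒≱ lt (≤-trans (hall R⊆B)
      (p⊆q⇒∣p∣≤∣q∣ (N⊆ K R λ h∈K βh∈R →
        ∈-N⁺ (K - g) R (x∈p∧x≢y⇒x∈p-y h∈K λ { refl → βg∉R βh∈R }) βh∈R)))

    b∈P : b ∈ₛ P
    b∈P = b∈ P⊆B P<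

    b∈Q : b ∈ₛ Q
    b∈Q = subst (_∈ₛ Q) (sym βe≡βf) (b∈ Q⊆B Q<)

    -- Both violators contain b, so e still counts for Q after the deletion of f, and f for P after
    -- the deletion of e.
    N∪ : N K (P ∪ Q) ⊆ₛ N (K - e) P ∪ N (K - f) Q
    N∪ = N⊆ K (P ∪ Q) step
      where
      step : ∀ {h} → h ∈ₛ K → β h ∈ₛ P ∪ Q → α h ∈ₛ N (K - e) P ∪ N (K - f) Q
      step {h} h∈K βh∈ with h ≟ e | h ≟ f | x∈p∪q⁻ P Q βh∈
      ... | yes refl | _ | _ = x∈p∪q⁺ (inj₂ (∈-N⁺ (K - f) Q (x∈p∧x≢y⇒x∈p-y h∈K e≢f) b∈Q))
      ... | no h≢e | yes refl | _ =
              x∈p∪q⁺ (inj₁ (∈-N⁺ (K - e) P (x∈p∧x≢y⇒x∈p-y h∈K h≢e) (subst (_∈ₛ P) βe≡βf b∈P)))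
      ... | no h≢e | no h≢f | inj₁ βh∈P = x∈p∪q⁺ (inj₁ (∈-N⁺ (K - e) P (x∈p∧x≢y⇒x∈p-y h∈K h≢e) βh∈P))
      ... | no h≢e | no h≢f | inj₂ βh∈Q = x∈p∪q⁺ (inj₂ (∈-N⁺ (K - f) Q (x∈p∧x≢y⇒x∈p-y h∈K h≢f) βh∈Q))

    N∩ : N K (P ∩ Q - b) ⊆ₛ N (K - e) P ∩ N (K - f) Q
    N∩ = N⊆ K (P ∩ Q - b) λ {h} h∈K βh∈ →
      let βh∈P , βh∈Q = x∈p∩q⁻ P Q (x∈p-y⇒x∈p (P ∩ Q) βh∈)
          βh≢b        = x∈p-y⇒x≢y (P ∩ Q) βh∈
      in x∈p∩q⁺ ( ∈-N⁺ (K - e) P (x∈p∧x≢y⇒x∈p-y h∈K λ { refl → βh≢b refl }) βh∈P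
                , ∈-N⁺ (K - f) Q (x∈p∧x≢y⇒x∈p-y h∈K λ { refl → βh≢b (sym βe≡βf) }) βh∈Q)

    -- The two violators together lack two neighbours, but taking b out of the intersection accounts
    -- for only one.
    bound : suc (suc (∣ N (K - e) P ∣ + ∣ N (K - f) Q ∣)) ≤ suc (∣ N (K - e) P ∣ + ∣ N (K - f) Q ∣)
    bound = begin
      suc (suc (∣ N (K - e) P ∣ + ∣ N (K - f) Q ∣))  ≡⟨ cong suc (+-suc _ _) ⟨
      suc ∣ N (K - e) P ∣ + suc ∣ N (K - f) Q ∣      ≤⟨ +-mono-≤ P< Q< ⟩
      ∣ P ∣ + ∣ Q ∣                                  ≡⟨ ∣∪∣+∣∩∣ P Q ⟨
      ∣ P ∪ Q ∣ + ∣ P ∩ Q ∣                          ≤⟨ +-monoʳ-≤ ∣ P ∪ Q ∣ (∣p∣≤1+∣p-x∣ (P ∩ Q) b) ⟩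
      ∣ P ∪ Q ∣ + suc ∣ P ∩ Q - b ∣                  ≤⟨ +-mono-≤ (hall P∪Q⊆B) (s≤s (hall P∩Q-b⊆B)) ⟩
      ∣ N K (P ∪ Q) ∣ + suc ∣ N K (P ∩ Q - b) ∣      ≤⟨ +-mono-≤ (p⊆q⇒∣p∣≤∣q∣ N∪) (s≤s (p⊆q⇒∣p∣≤∣q∣ N∩)) ⟩
      ∣ N (K - e) P ∪ N (K - f) Q ∣ + suc ∣ N (K - e) P ∩ N (K - f) Q ∣ ≡⟨ +-suc _ _ ⟩
      suc (∣ N (K - e) P ∪ N (K - f) Q ∣ + ∣ N (K - e) P ∩ N (K - f) Q ∣) ≡⟨ cong suc (∣∪∣+∣∩∣ (N (K - e) P) _) ⟩
      suc (∣ N (K - e) P ∣ + ∣ N (K - f) Q ∣)        ∎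
      where
      P∪Q⊆B : P ∪ Q ⊆ₛ B
      P∪Q⊆B x∈ with x∈p∪q⁻ P Q x∈
      ... | inj₁ x∈P = P⊆B x∈P
      ... | inj₂ x∈Q = Q⊆B x∈Q
      P∩Q-b⊆B : P ∩ Q - b ⊆ₛ B
      P∩Q-b⊆B x∈ = P⊆B (p∩q⊆p P Q (x∈p-y⇒x∈p (P ∩ Q) x∈))

  ⁅⁆⊆B : ∀ {b} → b ∈ₛ B → ⁅ b ⁆ ⊆ₛ B
  ⁅⁆⊆B b∈B x∈ with refl ← x∈⁅y⁆⇒x≡y _ x∈ = b∈B

  hall⇒edge : ∀ {K b} → Hall K → b ∈ₛ B → ∃ λ e → e ∈ₛ K × β e ≡ b
  hall⇒edge {K} {b} hall b∈B
    with _ , v∈ ← 0<∣p∣⇒Nonempty (N K ⁅ b ⁆)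
                    (≤-trans (≤-reflexive (sym (∣⁅x⁆∣≡1 b))) (hall (⁅⁆⊆B b∈B)))
    with e , e∈K , _ , βe∈ ← ∈-N⁻ K ⁅ b ⁆ v∈ = e , e∈K , x∈⁅y⁆⇒x≡y b βe∈

  -- As long as two edges share a B-end, one of them can be deleted without losing Hall's condition.
  -- In the end each vertex of B has exactly one edge, and Hall's condition with |A| = |B| makes the
  -- resulting map to A bijective.
  hall⇒perfectMatching : ∣ A ∣ ≡ ∣ B ∣ → ∀ {K} → Hall K → ∃ λ M → PerfectMatching G M × M ⊆ₛ K
  hall⇒perfectMatching ∣A∣≡∣B∣ {K} hall = go K hall (λ e∈ → e∈) (⊂-wellFounded K)
    where
    functional⇒perfectMatching : ∀ {M} → Hall M →
      (∀ {e f} → e ∈ₛ M → f ∈ₛ M → β e ≡ β f → e ≡ f) → PerfectMatching G M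
    functional⇒perfectMatching {M} hallM functional v with A⊎B v
    ... | inj₂ v∈B with e , e∈M , refl ← hall⇒edge {M} hallM v∈B =
      e , (e∈M , incident-β e) , λ (f∈M , v~f) → functional e∈M f∈M (incident-B v∈B v~f)
    ... | inj₁ v∈A = e , (e∈M , subst (λ u → Incident G u e) αe≡v (incident-α e)) ,
                     λ (f∈M , v~f) → unique f∈M (trans αe≡v (incident-A v∈A v~f))
      where
      -- Hall's condition for B itself: without v there would be fewer than |A| = |B| neighbours.
      v∈N : v ∈ₛ N M B
      v∈N = decidable-stable (v ∈? N M B) λ v∉N → <⇒≱
        (≤-trans (s≤s (p⊆q⇒∣p∣≤∣q∣ {q = A - v} λ x∈ →
          x∈p∧x≢y⇒x∈p-y (N⊆A M B x∈) λ { refl → v∉N x∈ })) (x∈p⇒∣p-x∣<∣p∣ v∈A))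
        (≤-trans (≤-reflexive ∣A∣≡∣B∣) (hallM (λ x∈ → x∈)))
      e : E
      e = proj₁ (∈-N⁻ M B v∈N)
      e∈M : e ∈ₛ M
      e∈M = proj₁ (proj₂ (∈-N⁻ M B v∈N))
      αe≡v : α e ≡ v
      αe≡v = proj₁ (proj₂ (proj₂ (∈-N⁻ M B v∈N)))
      unique : ∀ {f} → f ∈ₛ M → α e ≡ α f → e ≡ f
      unique {f} f∈M αe≡αf with β e ≟ β f
      ... | yes βe≡βf = functional e∈M f∈M βe≡βf
      -- Two edges at v with distinct B-ends would give a pair in B whose only neighbour is v.
      ... | no  βe≢βf = contradiction (hallM pair⊆B) (<⇒≱
              (≤-trans (s≤s (≤-trans (p⊆q⇒∣p∣≤∣q∣ N⊆a) (≤-reflexive (∣⁅x⁆∣≡1 (α e)))))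
                (distinct₂⇒1<∣p∣ (x∈p∪q⁺ (inj₁ (x∈⁅x⁆ (β e)))) (x∈p∪q⁺ (inj₂ (x∈⁅x⁆ (β f)))) βe≢βf)))
        where
        pair : VertexSet
        pair = ⁅ β e ⁆ ∪ ⁅ β f ⁆
        pair⊆B : pair ⊆ₛ B
        pair⊆B x∈ with x∈p∪q⁻ ⁅ β e ⁆ _ x∈
        ... | inj₁ x∈e = ⁅⁆⊆B (β∈B e) x∈e
        ... | inj₂ x∈f = ⁅⁆⊆B (β∈B f) x∈f
        N⊆a : N M pair ⊆ₛ ⁅ α e ⁆
        N⊆a = N⊆ M pair λ {g} g∈M βg∈ → subst (_∈ₛ ⁅ α e ⁆) (sym (αg≡ g∈M βg∈)) (x∈⁅x⁆ (α e))
          where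
          αg≡ : ∀ {g} → g ∈ₛ M → β g ∈ₛ pair → α g ≡ α e
          αg≡ g∈M βg∈ with x∈p∪q⁻ ⁅ β e ⁆ _ βg∈
          ... | inj₁ x∈e = cong α (functional g∈M e∈M (x∈⁅y⁆⇒x≡y (β e) x∈e))
          ... | inj₂ x∈f = trans (cong α (functional g∈M f∈M (x∈⁅y⁆⇒x≡y (β f) x∈f))) (sym αe≡αf)

    go : ∀ L → Hall L → L ⊆ₛ K → Acc _⊂_ L → ∃ λ M → PerfectMatching G M × M ⊆ₛ K
    go L hallL L⊆K (acc rec)
      with any? (λ e → any? λ f → (e ∈? L) ×-dec (f ∈? L) ×-dec (β e ≟ β f) ×-dec ¬? (e ≟ f))
    ... | no none = L , functional⇒perfectMatching {L} hallL
            (λ {e} {f} e∈L f∈L βe≡βf → decidable-stable (e ≟ f) λ e≢f →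
              none (e , f , e∈L , f∈L , βe≡βf , e≢f)) , L⊆K
    ... | yes (e , f , e∈L , f∈L , βe≡βf , e≢f) with hall-deletion {L} hallL e≢f βe≡βf
    ...   | inj₁ hall′ = go (L - e) hall′ (L⊆K ∘ x∈p-y⇒x∈p L) (rec (x∈p⇒p-x⊂p e∈L))
    ...   | inj₂ hall′ = go (L - f) hall′ (L⊆K ∘ x∈p-y⇒x∈p L) (rec (x∈p⇒p-x⊂p f∈L))

  -- Keep e and the edges of K that share no end with it. A set avoiding `β e` loses at most the
  -- neighbour `α e`, which the surplus makes up for; a set containing `β e` has `α e` as a
  -- neighbour through e itself.
  surplus⇒perfectMatching : ∣ A ∣ ≡ ∣ B ∣ → ∀ {K e} → Surplus K → e ∈ₛ K →
    ∃ λ M → PerfectMatching G M × e ∈ₛ M × M ⊆ₛ K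
  surplus⇒perfectMatching ∣A∣≡∣B∣ {K} {e} surplus e∈K =
      let M , pm , M⊆K′ = hall⇒perfectMatching ∣A∣≡∣B∣ {K′} hall′ in
      M , pm , e∈M pm M⊆K′ , λ {f} f∈M → proj₁ (∈-subset⁻ keep? (M⊆K′ f∈M))
    where
    keep? : ∀ f → Dec (f ∈ₛ K × (α f ≡ α e → f ≡ e) × (β f ≡ β e → f ≡ e))
    keep? f = (f ∈? K) ×-dec ((α f ≟ α e) →-dec (f ≟ e)) ×-dec ((β f ≟ β e) →-dec (f ≟ e))
    K′ : EdgeSet
    K′ = subset keep?
    e∈M : ∀ {M} → PerfectMatching G M → M ⊆ₛ K′ → e ∈ₛ M
    e∈M {M} pm M⊆K′ =
      let open Matching pm in
      subst (_∈ₛ M)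
            (proj₂ (proj₂ (∈-subset⁻ keep? (M⊆K′ (μ∈M (β e))))) (β-μ (β∈B e)))
            (μ∈M (β e))
    avoid : ∀ {Q} → Q ⊆ₛ B → β e ∉ₛ Q → ∣ Q ∣ ≤ ∣ N K Q - α e ∣
    avoid {Q} Q⊆B βe∉Q with nonempty? Q
    ... | yes ne = s≤s⁻¹ (≤-trans
            (surplus ((λ {_} → Q⊆B) , ne , β e , β∈B e , βe∉Q)) (∣p∣≤1+∣p-x∣ (N K Q) (α e)))
    ... | no ¬ne with refl ← Empty-unique ¬ne = ≤-trans (≤-reflexive (∣⊥∣≡0 (order G))) z≤n
    shrink : ∀ {P Q} → β e ∉ₛ P → P ⊆ₛ Q → N K P - α e ⊆ₛ N K′ Q - α e
    shrink {P} {Q} βe∉P P⊆Q x∈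
      with f , f∈K , refl , βf∈P ← ∈-N⁻ K P (x∈p-y⇒x∈p (N K P) x∈)
      = x∈p∧x≢y⇒x∈p-y (∈-N⁺ K′ Q (∈-subset⁺ keep?
          (f∈K , (λ αf≡αe → contradiction αf≡αe (x∈p-y⇒x≢y (N K P) x∈))
               , (λ βf≡βe → contradiction (subst (_∈ₛ P) βf≡βe βf∈P) βe∉P))) (P⊆Q βf∈P))
          (x∈p-y⇒x≢y (N K P) x∈)
    hall′ : Hall K′
    hall′ {Q} Q⊆B with β e ∈? Q
    ... | no βe∉Q = ≤-trans (avoid Q⊆B βe∉Q)
                   (≤-trans (p⊆q⇒∣p∣≤∣q∣ (shrink {Q} {Q} βe∉Q (λ x∈ → x∈))) (∣p─q∣≤∣p∣ (N K′ Q) _))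
    ... | yes βe∈Q = begin
      ∣ Q ∣                        ≡⟨ x∈p⇒1+∣p-x∣≡∣p∣ Q βe∈Q ⟨
      suc ∣ Q - β e ∣              ≤⟨ s≤s (avoid (Q⊆B ∘ x∈p-y⇒x∈p Q) βe∉) ⟩
      suc ∣ N K (Q - β e) - α e ∣  ≤⟨ s≤s (p⊆q⇒∣p∣≤∣q∣ (shrink {Q - β e} {Q} βe∉ (x∈p-y⇒x∈p Q))) ⟩
      suc ∣ N K′ Q - α e ∣         ≤⟨ x∈p⇒∣p-x∣<∣p∣ (∈-N⁺ K′ Q
                                        (∈-subset⁺ keep? (e∈K , (λ _ → refl) , (λ _ → refl))) βe∈Q) ⟩
      ∣ N K′ Q ∣                   ∎
      where
      open ≤-Reasoning
      βe∉ : β e ∉ₛ Q - β e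
      βe∉ βe∈ = x∈p-y⇒x≢y Q βe∈ refl

  AdjacentIn : EdgeSet → V → V → Set
  AdjacentIn K u v = ∃ λ e → e ∈ₛ K × Joins G e u v

  adjacentIn? : ∀ K u v → Dec (AdjacentIn K u v)
  adjacentIn? K u v = any? λ e → (e ∈? K) ×-dec
    (≡-dec _≟_ _≟_ (ends G e) (u , v) ⊎-dec ≡-dec _≟_ _≟_ (ends G e) (v , u))

  -- If the component S of u missed v, then S would split B into two nonempty parts with disjoint
  -- neighbourhoods. Their surpluses would add up to more than |A| vertices in A.
  surplus⇒connected : ∣ A ∣ ≡ ∣ B ∣ → ∀ {K} → Surplus K →
    (∀ v → ∃ λ e → e ∈ₛ K × Incident G v e) → ∀ u v → Star (AdjacentIn K) u v
  surplus⇒connected ∣A∣≡∣B∣ {K} surplus edgeAt u v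
    with S , u∈S , reach , closed ← reachableSet (adjacentIn? K) u
    with v ∈? S
  ... | yes v∈S = reach v∈S
  ... | no  v∉S = contradiction bound (<⇒≱ (n<1+n _))
    where
    open ≤-Reasoning
    α⇒β : ∀ {e} → e ∈ₛ K → α e ∈ₛ S → β e ∈ₛ S
    α⇒β {e} e∈K αe∈S = closed αe∈S (e , e∈K , joins e)
    β⇒α : ∀ {e} → e ∈ₛ K → β e ∈ₛ S → α e ∈ₛ S
    β⇒α {e} e∈K βe∈S = closed βe∈S (e , e∈K , joins-sym (joins e))
    P Q : VertexSet
    P = B ∩ S
    Q = B ─ S
    b∈P : ∃ λ b → b ∈ₛ P
    b∈P with e , e∈K , u~e ← edgeAt u with incident⇒α⊎β u~e
    ... | inj₁ refl = β e , x∈p∩q⁺ (β∈B e , α⇒β e∈K u∈S)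
    ... | inj₂ refl = β e , x∈p∩q⁺ (β∈B e , u∈S)
    b∈Q : ∃ λ b → b ∈ₛ Q
    b∈Q with e , e∈K , v~e ← edgeAt v with incident⇒α⊎β v~e
    ... | inj₁ refl = β e , x∈p∧x∉q⇒x∈p─q (β∈B e) (v∉S ∘ β⇒α e∈K)
    ... | inj₂ refl = β e , x∈p∧x∉q⇒x∈p─q (β∈B e) v∉S
    P-proper : Proper P
    P-proper = (λ {_} → p∩q⊆p B S) , b∈P , proj₁ b∈Q , p─q⊆p B S (proj₂ b∈Q) ,
               λ b∈ → x∈p─q⇒x∉q B S (proj₂ b∈Q) (p∩q⊆q B S b∈)
    Q-proper : Proper Q
    Q-proper = (λ {_} → p─q⊆p B S) , b∈Q , proj₁ b∈P , p∩q⊆p B S (proj₂ b∈P) ,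
               λ b∈ → x∈p─q⇒x∉q B S b∈ (p∩q⊆q B S (proj₂ b∈P))
    B⊆ : B ⊆ₛ P ∪ Q
    B⊆ {x} x∈B with x ∈? S
    ... | yes x∈S = x∈p∪q⁺ (inj₁ (x∈p∩q⁺ (x∈B , x∈S)))
    ... | no  x∉S = x∈p∪q⁺ (inj₂ (x∈p∧x∉q⇒x∈p─q x∈B x∉S))
    disjoint : ∣ N K P ∩ N K Q ∣ ≡ 0
    disjoint = trans (cong ∣_∣ (Empty-unique {p = N K P ∩ N K Q} empty)) (∣⊥∣≡0 (order G))
      where
      empty : Empty (N K P ∩ N K Q)
      empty (x , x∈) with x∈P , x∈Q ← x∈p∩q⁻ (N K P) _ x∈
        with e , e∈K , refl , βe∈P ← ∈-N⁻ K P x∈P | f , f∈K , eq , βf∈Q ← ∈-N⁻ K Q x∈Q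
        = x∈p─q⇒x∉q B S βf∈Q (α⇒β f∈K (subst (_∈ₛ S) (sym eq) (β⇒α e∈K (p∩q⊆q B S βe∈P))))
    ∪⊆A : N K P ∪ N K Q ⊆ₛ A
    ∪⊆A x∈ with x∈p∪q⁻ (N K P) _ x∈
    ... | inj₁ x∈P = N⊆A K P x∈P
    ... | inj₂ x∈Q = N⊆A K Q x∈Q
    bound : suc ∣ B ∣ ≤ ∣ B ∣
    bound = begin
      suc ∣ B ∣                             ≤⟨ s≤s (p⊆q⇒∣p∣≤∣q∣ B⊆) ⟩
      suc ∣ P ∪ Q ∣                         ≤⟨ s≤s (m≤m+n _ ∣ P ∩ Q ∣) ⟩
      suc (∣ P ∪ Q ∣ + ∣ P ∩ Q ∣)           ≡⟨ cong suc (∣∪∣+∣∩∣ P Q) ⟩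
      suc ∣ P ∣ + ∣ Q ∣                     ≤⟨ +-mono-≤ (surplus P-proper) (<⇒≤ (surplus Q-proper)) ⟩
      ∣ N K P ∣ + ∣ N K Q ∣                 ≡⟨ ∣∪∣+∣∩∣ (N K P) (N K Q) ⟨
      ∣ N K P ∪ N K Q ∣ + ∣ N K P ∩ N K Q ∣ ≡⟨ trans (cong (∣ N K P ∪ N K Q ∣ +_) disjoint) (+-identityʳ _) ⟩
      ∣ N K P ∪ N K Q ∣                     ≤⟨ p⊆q⇒∣p∣≤∣q∣ ∪⊆A ⟩
      ∣ A ∣                                 ≡⟨ ∣A∣≡∣B∣ ⟩
      ∣ B ∣                                 ∎

-- Matching covered graphs

module _ (G : Graph) where

  degree≡ : ∀ v → degree G v ≡ ∣ subset (incident? G v) ∣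
  degree≡ v = length-filter-allFin (incident? G v)

  third : ∀ {v} → 2 < degree G v → ∀ e f → ∃ λ g → Incident G v g × g ≢ e × g ≢ f
  third {v} 2<d e f =
    let g , g∈ , g≢e , g≢f = 2<∣p∣⇒another (subset (incident? G v)) (subst (2 <_) (degree≡ v) 2<d) e f
    in  g , ∈-subset⁻ (incident? G v) g∈ , g≢e , g≢f

  1<degree : ∀ {v e f} → Incident G v e → Incident G v f → e ≢ f → 1 < degree G v
  1<degree {v} v~e v~f e≢f = subst (1 <_) (sym (degree≡ v)) (distinct₂⇒1<∣p∣
    (∈-subset⁺ (incident? G v) v~e) (∈-subset⁺ (incident? G v) v~f) e≢f)

  no-third : ∀ {v e f g} → ¬ 2 < degree G v →
             Incident G v e → Incident G v f → Incident G v g → e ≢ f → g ≡ e ⊎ g ≡ f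
  no-third {v} {e} {f} {g} d≤2 v~e v~f v~g e≢f with g ≟ e | g ≟ f
  ... | yes g≡e | _       = inj₁ g≡e
  ... | no _    | yes g≡f = inj₂ g≡f
  ... | no g≢e  | no g≢f  = contradiction (subst (2 <_) (sym (degree≡ v)) (distinct₃⇒2<∣p∣
    (∈-subset⁺ (incident? G v) v~g) (∈-subset⁺ (incident? G v) v~e)
    (∈-subset⁺ (incident? G v) v~f) g≢e g≢f e≢f)) d≤2

-- Absorbs the renumbering of edges: the hypotheses speak of G with e avoided, and `punchIn` and
-- `punchOut` carry them over to the smaller graph.
-ₑ-matchingCovered : ∀ G e → 4 ≤ order G →
  (∀ u v → Star (λ u v → ∃ λ f → f ≢ e × Joins G f u v) u v) →
  (∀ f → f ≢ e → ∃ λ M → PerfectMatching G M × f ∈ₛ M × e ∉ₛ M) →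
  MatchingCovered (G -ₑ e)
-ₑ-matchingCovered G@(graph n (suc m) ends l) e 4≤n connected covered =
  4≤n , (λ u v → Star.map adjacent (connected u v)) , covered′
  where
  adjacent : ∀ {u v} → (∃ λ f → f ≢ e × Joins G f u v) → Adjacent (G -ₑ e) u v
  adjacent (f , f≢e , j) = punchOut (f≢e ∘ sym) ,
    subst (λ g → Joins G g _ _) (sym (punchIn-punchOut (f≢e ∘ sym))) j

  covered′ : ∀ f → ∃ λ M → PerfectMatching (G -ₑ e) M × f ∈ₛ M
  covered′ f with M , pm , f∈M , e∉M ← covered (punchIn e f) (punchInᵢ≢i e f)
    = M′ , pm′ , ∈-subset⁺ kept? f∈M
    where
    kept? : ∀ g → Dec (punchIn e g ∈ₛ M)
    kept? g = punchIn e g ∈? M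
    M′ : Subset m
    M′ = subset kept?
    pm′ : PerfectMatching (G -ₑ e) M′
    pm′ v with g , (g∈M , v~g) , unique ← pm v =
      g′ , (∈-subset⁺ kept? (subst (_∈ₛ M) (sym g≡) g∈M) , subst (Incident G v) (sym g≡) v~g) ,
      λ (h∈M′ , v~h) → punchIn-injective e _ _
        (trans g≡ (unique (∈-subset⁻ kept? h∈M′ , v~h)))
      where
      e≢g : e ≢ g
      e≢g refl = e∉M g∈M
      g′ : Fin m
      g′ = punchOut e≢g
      g≡ : punchIn e g′ ≡ g
      g≡ = punchIn-punchOut e≢g

module Covered (G : Graph) (side : Vertex G → Bool)
               (bipartite : ∀ e → side (proj₁ (ends G e)) ≢ side (proj₂ (ends G e)))
               (covered : MatchingCovered G) where

  open Sided G side bipartite public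

  private
    V = Vertex G
    E = Edge G
    VertexSet = Subset (order G)

  2≤n : 2 ≤ order G
  2≤n = ≤-trans (s≤s (s≤s z≤n)) (proj₁ covered)

  edgeAt : ∀ v → ∃ (Incident G v)
  edgeAt v with u , _ , u≢v ← 1<∣p∣⇒another ⊤ (subst (1 <_) (sym (∣⊤∣≡n (order G))) 2≤n) v
    with proj₁ (proj₂ covered) v u
  ... | ε = contradiction refl u≢v
  ... | (e , inj₁ eq) ◅ _ = e , inj₁ (sym (cong proj₁ eq))
  ... | (e , inj₂ eq) ◅ _ = e , inj₂ (sym (cong proj₂ eq))

  edgeAt-β : ∀ {b} → b ∈ₛ B → ∃ λ e → β e ≡ b
  edgeAt-β b∈B with e , b~e ← edgeAt _ = e , sym (incident-B b∈B b~e)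

  matchingThrough : ∀ e → ∃ λ M → PerfectMatching G M × e ∈ₛ M
  matchingThrough = proj₂ (proj₂ covered)

  -- By connectedness some edge f leads from N(Q) to a vertex outside Q. A perfect matching through
  -- f sends Q injectively into N(Q) without `α f`.
  surplus : Surplus ⊤
  surplus {Q} (Q⊆B , (b , b∈Q) , c , c∈B , c∉Q)
    with any? (λ f → (α f ∈? N ⊤ Q) ×-dec ¬? (β f ∈? Q))
  ... | yes (f , αf∈N , βf∉Q) with M , pm , f∈M ← matchingThrough f =
    let open Matching pm in
    ≤-trans (s≤s (injectiveOn⇒∣p∣≤∣q∣ Q (α ∘ μ)
      (λ x∈Q → x∈p∧x≢y⇒x∈p-y (∈-N⁺ ⊤ Q ∈⊤ (subst (_∈ₛ Q) (sym (β-μ (Q⊆B x∈Q))) x∈Q))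
        (λ eq → βf∉Q (subst (_∈ₛ Q) (trans (sym (β-μ (Q⊆B x∈Q)))
          (cong β (same-α (μ∈M _) f∈M eq))) x∈Q)))
      (λ x∈Q y∈Q → α∘μ-injective (Q⊆B x∈Q) (Q⊆B y∈Q))))
    (x∈p⇒∣p-x∣<∣p∣ αf∈N)
  -- Without such an edge, Q together with N(Q) is closed under adjacency, yet it misses c.
  ... | no none = contradiction (spread (proj₁ (proj₂ covered) b c) (inj₁ b∈Q)) c∉
    where
    c∉ : ¬ (c ∈ₛ Q ⊎ c ∈ₛ N ⊤ Q)
    c∉ (inj₁ c∈Q) = c∉Q c∈Q
    c∉ (inj₂ c∈N) = A-∉-B (N⊆A ⊤ Q c∈N) c∈B
    step : ∀ {u v} → Adjacent G u v → u ∈ₛ Q ⊎ u ∈ₛ N ⊤ Q → v ∈ₛ Q ⊎ v ∈ₛ N ⊤ Q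
    step (e , j) u∈ with joins⇒ j | u∈
    ... | inj₁ (refl , refl) | inj₁ u∈Q = contradiction (Q⊆B u∈Q) (A-∉-B (α∈A e))
    ... | inj₁ (refl , refl) | inj₂ u∈N =
      inj₁ (decidable-stable (β e ∈? Q) λ βe∉Q → none (e , u∈N , βe∉Q))
    ... | inj₂ (refl , refl) | inj₁ u∈Q = inj₂ (∈-N⁺ ⊤ Q ∈⊤ u∈Q)
    ... | inj₂ (refl , refl) | inj₂ u∈N = contradiction (β∈B e) (A-∉-B (N⊆A ⊤ Q u∈N))
    spread : ∀ {u v} → Star (Adjacent G) u v → u ∈ₛ Q ⊎ u ∈ₛ N ⊤ Q → v ∈ₛ Q ⊎ v ∈ₛ N ⊤ Q
    spread ε u∈ = u∈
    spread (uv ◅ vw) u∈ = spread vw (step uv u∈)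

  someEdge : E
  someEdge = proj₁ (edgeAt (fromℕ< 2≤n))

  ∣A∣≡∣B∣ : ∣ A ∣ ≡ ∣ B ∣
  ∣A∣≡∣B∣ = Matching.∣A∣≡∣B∣ (proj₁ (proj₂ (matchingThrough someEdge)))

  1<∣B∣ : 1 < ∣ B ∣
  1<∣B∣ = ≰⇒> λ ∣B∣≤1 → <⇒≱ (s≤s (s≤s (s≤s z≤n))) (begin
    4             ≤⟨ proj₁ covered ⟩
    order G       ≡⟨ ∣A∣+∣B∣≡n ⟨
    ∣ A ∣ + ∣ B ∣ ≡⟨ cong (_+ ∣ B ∣) ∣A∣≡∣B∣ ⟩
    ∣ B ∣ + ∣ B ∣ ≤⟨ +-mono-≤ ∣B∣≤1 ∣B∣≤1 ⟩
    2             ∎)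
    where open ≤-Reasoning

  ⁅⁆-proper : ∀ {b} → b ∈ₛ B → Proper ⁅ b ⁆
  ⁅⁆-proper {b} b∈B = (λ {_} → ⁅⁆⊆B b∈B) , (b , x∈⁅x⁆ b) ,
    let c , c∈B , c≢b = 1<∣p∣⇒another B 1<∣B∣ b in c , c∈B , c≢b ∘ x∈⁅y⁆⇒x≡y b

  another-β : ∀ e → ∃ λ f → f ≢ e × β f ≡ β e
  another-β e with any? (λ f → ¬? (f ≟ e) ×-dec (β f ≟ β e))
  ... | yes found = found
  ... | no none = contradiction (surplus (⁅⁆-proper (β∈B e))) (≤⇒≯ (begin
    ∣ N ⊤ ⁅ β e ⁆ ∣ ≤⟨ p⊆q⇒∣p∣≤∣q∣ (N⊆ ⊤ ⁅ β e ⁆ λ {f} _ βf∈ → subst (λ g → α f ∈ₛ ⁅ α g ⁆)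
                        (decidable-stable (f ≟ e) (λ f≢e → none (f , f≢e , x∈⁅y⁆⇒x≡y (β e) βf∈)))
                        (x∈⁅x⁆ (α f))) ⟩
    ∣ ⁅ α e ⁆ ∣     ≡⟨ ∣⁅x⁆∣≡1 (α e) ⟩
    1               ≡⟨ ∣⁅x⁆∣≡1 (β e) ⟨
    ∣ ⁅ β e ⁆ ∣     ∎))
    where
    open ≤-Reasoning

  -- Were e the only edge at `α e`, all neighbours of B - `β e` would lie in A - `α e`, which is no
  -- larger, against the surplus.
  another-α : ∀ e → ∃ λ f → f ≢ e × α f ≡ α e
  another-α e with any? (λ f → ¬? (f ≟ e) ×-dec (α f ≟ α e))
  ... | yes found = found
  ... | no none = contradiction (surplus proper) (≤⇒≯ (s≤s⁻¹ (begin
    suc ∣ N ⊤ (B - β e) ∣ ≤⟨ s≤s (p⊆q⇒∣p∣≤∣q∣ (N⊆ ⊤ (B - β e) λ {f} _ βf∈ → x∈p∧x≢y⇒x∈p-y (α∈A f)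
                               λ αf≡αe → none (f , (λ { refl → x∈p-y⇒x≢y B βf∈ refl }) , αf≡αe))) ⟩
    suc ∣ A - α e ∣       ≡⟨ x∈p⇒1+∣p-x∣≡∣p∣ A (α∈A e) ⟩
    ∣ A ∣                 ≡⟨ ∣A∣≡∣B∣ ⟩
    ∣ B ∣                 ≤⟨ ∣p∣≤1+∣p-x∣ B (β e) ⟩
    suc ∣ B - β e ∣       ∎)))
    where
    open ≤-Reasoning
    proper : Proper (B - β e)
    proper = (λ {_} → x∈p-y⇒x∈p B) ,
      (let c , c∈B , c≢ = 1<∣p∣⇒another B 1<∣B∣ (β e) in c , x∈p∧x≢y⇒x∈p-y c∈B c≢) ,
      β e , β∈B e , λ βe∈ → x∈p-y⇒x≢y B βe∈ refl

  another : ∀ {v e} → Incident G v e → ∃ λ f → f ≢ e × Incident G v f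
  another {e = e} v~e with incident⇒α⊎β v~e
  ... | inj₁ refl = let f , f≢e , eq = another-α e in
                    f , f≢e , subst (λ v → Incident G v f) eq (incident-α f)
  ... | inj₂ refl = let f , f≢e , eq = another-β e in
                    f , f≢e , subst (λ v → Incident G v f) eq (incident-β f)

  1<degree-all : ∀ v → 1 < degree G v
  1<degree-all v with e , v~e ← edgeAt v with f , f≢e , v~f ← another v~e = 1<degree G v~f v~e f≢e

  -- Q witnesses that deleting e destroys matching coveredness.
  Tight : E → VertexSet → Set
  Tight e Q = β e ∈ₛ Q × Q ⊆ₛ B × ∣ N ⊤ Q ∣ ≤ suc ∣ Q ∣ × (∀ f → α f ≡ α e → β f ∈ₛ Q → f ≡ e)

  tight? : ∀ e Q → Dec (Tight e Q)
  tight? e Q = (β e ∈? Q) ×-dec (Q ⊆? B) ×-dec (∣ N ⊤ Q ∣ ℕ.≤? suc ∣ Q ∣) ×-dec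
               all? λ f → (α f ≟ α e) →-dec ((β f ∈? Q) →-dec (f ≟ e))

  -- Deleting e can shrink N(Q) only if `β e` lies in Q and no other edge joins `α e` to Q. Then
  -- only `α e` is lost, and since Q is not tight its surplus is at least two.
  ¬tight⇒surplus : ∀ e → ¬ ∃ (Tight e) → Surplus (⊤ - e)
  ¬tight⇒surplus e ¬tight {Q} proper@(Q⊆B , _)
    with β e ∈? Q | any? (λ f → (α f ≟ α e) ×-dec (β f ∈? Q) ×-dec ¬? (f ≟ e))
  ... | no βe∉Q | _ = ≤-trans (surplus proper) (p⊆q⇒∣p∣≤∣q∣ (N⊆ ⊤ Q λ f∈ βf∈Q →
          ∈-N⁺ (⊤ - e) Q (x∈p∧x≢y⇒x∈p-y f∈ λ { refl → βe∉Q βf∈Q }) βf∈Q))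
  ... | yes βe∈Q | yes (g , αg≡αe , βg∈Q , g≢e) =
          ≤-trans (surplus proper) (p⊆q⇒∣p∣≤∣q∣ (N⊆ ⊤ Q λ {f} _ βf∈Q → avoid f βf∈Q))
    where
    avoid : ∀ f → β f ∈ₛ Q → α f ∈ₛ N (⊤ - e) Q
    avoid f βf∈Q with f ≟ e
    ... | yes refl = subst (_∈ₛ N (⊤ - e) Q) αg≡αe (∈-N⁺ (⊤ - e) Q (x∈p∧x≢y⇒x∈p-y ∈⊤ g≢e) βg∈Q)
    ... | no  f≢e  = ∈-N⁺ (⊤ - e) Q (x∈p∧x≢y⇒x∈p-y ∈⊤ f≢e) βf∈Q
  ... | yes βe∈Q | no none = s≤s⁻¹ (begin
    suc (suc ∣ Q ∣)         ≤⟨ ≰⇒> (λ small → ¬tight (Q , βe∈Q , (λ {_} → Q⊆B) , small , only)) ⟩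
    ∣ N ⊤ Q ∣               ≤⟨ ∣p∣≤1+∣p-x∣ (N ⊤ Q) (α e) ⟩
    suc ∣ N ⊤ Q - α e ∣     ≤⟨ s≤s (p⊆q⇒∣p∣≤∣q∣ delete) ⟩
    suc ∣ N (⊤ - e) Q ∣     ∎)
    where
    open ≤-Reasoning
    only : ∀ f → α f ≡ α e → β f ∈ₛ Q → f ≡ e
    only f αf≡αe βf∈Q = decidable-stable (f ≟ e) λ f≢e → none (f , αf≡αe , βf∈Q , f≢e)
    delete : N ⊤ Q - α e ⊆ₛ N (⊤ - e) Q
    delete x∈ with f , f∈ , refl , βf∈Q ← ∈-N⁻ ⊤ Q (x∈p-y⇒x∈p (N ⊤ Q) x∈) =
      ∈-N⁺ (⊤ - e) Q (x∈p∧x≢y⇒x∈p-y f∈ λ { refl → x∈p-y⇒x≢y (N ⊤ Q) x∈ refl }) βf∈Q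

  -- Applied in contrapositive form: in a minimal graph every edge has a tight set.
  ¬tight⇒-ₑ-matchingCovered : ∀ e → ¬ ∃ (Tight e) → MatchingCovered (G -ₑ e)
  ¬tight⇒-ₑ-matchingCovered e ¬tight = -ₑ-matchingCovered G e (proj₁ covered)
    (λ u v → Star.map (λ (f , f∈ , j) → f , x∈p-y⇒x≢y ⊤ f∈ , j)
      (surplus⇒connected ∣A∣≡∣B∣ surplus′ edgeAt′ u v))
    (λ f f≢e → let M , pm , f∈M , M⊆ = surplus⇒perfectMatching ∣A∣≡∣B∣ surplus′ (x∈p∧x≢y⇒x∈p-y ∈⊤ f≢e)
               in  M , pm , f∈M , λ e∈M → x∈p-y⇒x≢y ⊤ (M⊆ e∈M) refl)
    where
    surplus′ : Surplus (⊤ - e)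
    surplus′ {Q} = ¬tight⇒surplus e ¬tight {Q}
    edgeAt′ : ∀ v → ∃ λ f → f ∈ₛ ⊤ - e × Incident G v f
    edgeAt′ v with f , v~f ← edgeAt v with f ≟ e
    ... | no f≢e = f , x∈p∧x≢y⇒x∈p-y ∈⊤ f≢e , v~f
    ... | yes refl with g , g≢e , v~g ← another v~f = g , x∈p∧x≢y⇒x∈p-y ∈⊤ g≢e , v~g

-- Branches in minimal graphs

module Minimal (G : Graph) (side : Vertex G → Bool)
               (bipartite : ∀ e → side (proj₁ (ends G e)) ≢ side (proj₂ (ends G e)))
               (minimal : MinimalMatchingCovered G) where

  open Covered G side bipartite (proj₁ minimal) public

  private
    V = Vertex G
    E = Edge G
    VertexSet = Subset (order G)

  Heavy : V → Set
  Heavy v = 2 < degree G v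

  heavy? : ∀ v → Dec (Heavy v)
  heavy? v = 2 ℕ.<? degree G v

  third-α : ∀ {e} → Heavy (α e) → ∀ f → ∃ λ g → α g ≡ α e × g ≢ e × g ≢ f
  third-α {e} heavy f with g , v~g , g≢e , g≢f ← third G heavy e f =
    g , sym (incident-A (α∈A e) v~g) , g≢e , g≢f

  -- Sharper than submodularity, because N(P) ∩ N(Q) may be larger than N(P ∩ Q). The lemmas on
  -- tight sets exploit this excess.
  N-submodular : ∀ P Q → ∣ N ⊤ (P ∪ Q) ∣ + ∣ N ⊤ P ∩ N ⊤ Q ∣ ≤ ∣ N ⊤ P ∣ + ∣ N ⊤ Q ∣
  N-submodular P Q = begin
    ∣ N ⊤ (P ∪ Q) ∣ + ∣ N ⊤ P ∩ N ⊤ Q ∣     ≤⟨ +-monoˡ-≤ _ (p⊆q⇒∣p∣≤∣q∣ N∪) ⟩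
    ∣ N ⊤ P ∪ N ⊤ Q ∣ + ∣ N ⊤ P ∩ N ⊤ Q ∣   ≡⟨ ∣∪∣+∣∩∣ (N ⊤ P) (N ⊤ Q) ⟩
    ∣ N ⊤ P ∣ + ∣ N ⊤ Q ∣                   ∎
    where
    open ≤-Reasoning
    N∪ : N ⊤ (P ∪ Q) ⊆ₛ N ⊤ P ∪ N ⊤ Q
    N∪ = N⊆ ⊤ (P ∪ Q) step
      where
      step : ∀ {f} → f ∈ₛ ⊤ → β f ∈ₛ P ∪ Q → α f ∈ₛ N ⊤ P ∪ N ⊤ Q
      step _ βf∈ with x∈p∪q⁻ P Q βf∈
      ... | inj₁ βf∈P = x∈p∪q⁺ (inj₁ (∈-N⁺ ⊤ P ∈⊤ βf∈P))
      ... | inj₂ βf∈Q = x∈p∪q⁺ (inj₂ (∈-N⁺ ⊤ Q ∈⊤ βf∈Q))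

  module _ {e f P Q} (tightP : Tight e P) (tightQ : Tight f Q) where

    private
      sizes : ∣ N ⊤ (P ∪ Q) ∣ + ∣ N ⊤ P ∩ N ⊤ Q ∣ ≤ suc ∣ P ∪ Q ∣ + suc ∣ P ∩ Q ∣
      sizes = begin
        ∣ N ⊤ (P ∪ Q) ∣ + ∣ N ⊤ P ∩ N ⊤ Q ∣ ≤⟨ N-submodular P Q ⟩
        ∣ N ⊤ P ∣ + ∣ N ⊤ Q ∣               ≤⟨ +-mono-≤ (proj₁ (proj₂ (proj₂ tightP)))
                                                        (proj₁ (proj₂ (proj₂ tightQ))) ⟩
        suc ∣ P ∣ + suc ∣ Q ∣               ≡⟨ cong suc (+-suc ∣ P ∣ ∣ Q ∣) ⟩
        suc (suc (∣ P ∣ + ∣ Q ∣))           ≡⟨ cong (λ k → suc (suc k)) (∣∪∣+∣∩∣ P Q) ⟨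
        suc (suc (∣ P ∪ Q ∣ + ∣ P ∩ Q ∣))   ≡⟨ cong suc (+-suc ∣ P ∪ Q ∣ ∣ P ∩ Q ∣) ⟨
        suc ∣ P ∪ Q ∣ + suc ∣ P ∩ Q ∣       ∎
        where open ≤-Reasoning

    ∪⊆B : P ∪ Q ⊆ₛ B
    ∪⊆B x∈ with x∈p∪q⁻ P Q x∈
    ... | inj₁ x∈P = proj₁ (proj₂ tightP) x∈P
    ... | inj₂ x∈Q = proj₁ (proj₂ tightQ) x∈Q

    -- Two tight sets leave a total slack of two. If their union is a proper subset of B, its
    -- surplus takes one unit, and one is left for the intersection.
    proper-∪⇒∣N∩N∣≤ : (∃ λ b → b ∈ₛ B × b ∉ₛ P ∪ Q) → ∣ N ⊤ P ∩ N ⊤ Q ∣ ≤ suc ∣ P ∩ Q ∣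
    proper-∪⇒∣N∩N∣≤ missed = +-cancelˡ-≤ (suc ∣ P ∪ Q ∣) _ _ (≤-trans
      (+-monoˡ-≤ ∣ N ⊤ P ∩ N ⊤ Q ∣ (surplus ((λ {_} → ∪⊆B) , (β e , p⊆p∪q Q (proj₁ tightP)) , missed)))
      sizes)

    <∣N∩N∣⇒∣N∪∣≤ : ∣ P ∩ Q ∣ < ∣ N ⊤ P ∩ N ⊤ Q ∣ → ∣ N ⊤ (P ∪ Q) ∣ ≤ suc ∣ P ∪ Q ∣
    <∣N∩N∣⇒∣N∪∣≤ lt = +-cancelʳ-≤ (suc ∣ P ∩ Q ∣) _ _ (≤-trans (+-monoʳ-≤ ∣ N ⊤ (P ∪ Q) ∣ lt) sizes)

    N∩⊆N∩N : N ⊤ (P ∩ Q) ⊆ₛ N ⊤ P ∩ N ⊤ Q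
    N∩⊆N∩N = N⊆ ⊤ (P ∩ Q) λ _ βg∈ → let βg∈P , βg∈Q = x∈p∩q⁻ P Q βg∈ in
      x∈p∩q⁺ (∈-N⁺ ⊤ P ∈⊤ βg∈P , ∈-N⁺ ⊤ Q ∈⊤ βg∈Q)

  -- The intersection contains `β e` and misses the B-end of any other edge at `α e`. It therefore
  -- has surplus, which takes one of the two units of slack and leaves one for the union.
  tight-∪ : ∀ {e P Q} → Tight e P → Tight e Q → Tight e (P ∪ Q)
  tight-∪ {e} {P} {Q} tightP@(βe∈P , P⊆B , _ , onlyP) tightQ@(βe∈Q , _ , _ , onlyQ) =
    p⊆p∪q Q βe∈P , ∪⊆B tightP tightQ ,
    <∣N∩N∣⇒∣N∪∣≤ tightP tightQ (≤-trans (surplus proper) (p⊆q⇒∣p∣≤∣q∣ (N∩⊆N∩N tightP tightQ))) ,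
    λ f αf≡αe βf∈ → only f αf≡αe (x∈p∪q⁻ P Q βf∈)
    where
    only : ∀ f → α f ≡ α e → β f ∈ₛ P ⊎ β f ∈ₛ Q → f ≡ e
    only f αf≡αe (inj₁ βf∈P) = onlyP f αf≡αe βf∈P
    only f αf≡αe (inj₂ βf∈Q) = onlyQ f αf≡αe βf∈Q
    proper : Proper (P ∩ Q)
    proper = (λ x∈ → P⊆B (p∩q⊆p P Q x∈)) , (β e , x∈p∩q⁺ (βe∈P , βe∈Q)) ,
      (let f , f≢e , αf≡αe = another-α e in
       β f , β∈B f , λ βf∈ → f≢e (onlyP f αf≡αe (p∩q⊆p P Q βf∈)))

  -- A third edge at `α e` ends outside both sets, so N(P) ∩ N(Q) has at most |P ∩ Q| + 1 elements.
  -- It contains `α e`, which is no neighbour of P ∩ Q; a further common neighbour x would push it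
  -- over the bound.
  N-tight-disjoint : ∀ {e f P Q x} → Heavy (α e) → α e ≡ α f → e ≢ f → Tight e P → Tight f Q →
                     x ∈ₛ N ⊤ P → x ∈ₛ N ⊤ Q → x ≡ α e
  N-tight-disjoint {e} {f} {P} {Q} {x} heavy αe≡αf e≢f
    tightP@(βe∈P , P⊆B , _ , onlyP) tightQ@(βf∈Q , _ , _ , onlyQ) x∈NP x∈NQ =
    decidable-stable (x ≟ α e) λ x≢αe → <⇒≱
      (≤-trans (s≤s (bound x≢αe)) (x∈p⇒∣p-x∣<∣p∣ αe∈N∩N))
      (proper-∪⇒∣N∩N∣≤ tightP tightQ missed)
    where
    βe∉Q : β e ∉ₛ Q
    βe∉Q βe∈Q = e≢f (onlyQ e αe≡αf βe∈Q)
    missed : ∃ λ b → b ∈ₛ B × b ∉ₛ P ∪ Q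
    missed with g , αg≡αe , g≢e , g≢f ← third-α heavy f = β g , β∈B g , λ βg∈ → βg∉ (x∈p∪q⁻ P Q βg∈)
      where
      βg∉ : ¬ (β g ∈ₛ P ⊎ β g ∈ₛ Q)
      βg∉ (inj₁ βg∈P) = g≢e (onlyP g αg≡αe βg∈P)
      βg∉ (inj₂ βg∈Q) = g≢f (onlyQ g (trans αg≡αe αe≡αf) βg∈Q)
    αe∈N∩N : α e ∈ₛ N ⊤ P ∩ N ⊤ Q
    αe∈N∩N = x∈p∩q⁺ (∈-N⁺ ⊤ P ∈⊤ βe∈P , subst (_∈ₛ N ⊤ Q) (sym αe≡αf) (∈-N⁺ ⊤ Q ∈⊤ βf∈Q))
    bound : x ≢ α e → ∣ P ∩ Q ∣ < ∣ N ⊤ P ∩ N ⊤ Q - α e ∣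
    bound x≢αe with nonempty? (P ∩ Q)
    -- Surplus says nothing about the empty set; here x itself is the excess vertex.
    ... | no ¬ne = ≤-trans
            (s≤s (≤-reflexive (trans (cong ∣_∣ (Empty-unique ¬ne)) (∣⊥∣≡0 (order G)))))
            (x∈p⇒0<∣p∣ (x∈p∧x≢y⇒x∈p-y (x∈p∩q⁺ (x∈NP , x∈NQ)) x≢αe))
    ... | yes ne = ≤-trans
            (surplus ((λ x∈ → P⊆B (p∩q⊆p P Q x∈)) , ne , β e , β∈B e , λ βe∈ → βe∉Q (p∩q⊆q P Q βe∈)))
            (p⊆q⇒∣p∣≤∣q∣ {q = N ⊤ P ∩ N ⊤ Q - α e} λ y∈ → x∈p∧x≢y⇒x∈p-y
              (N∩⊆N∩N tightP tightQ y∈) λ { refl → αe∉ (∈-N⁻ ⊤ (P ∩ Q) y∈) })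
      where
      αe∉ : ¬ ∃ λ g → g ∈ₛ ⊤ × α g ≡ α e × β g ∈ₛ P ∩ Q
      αe∉ (g , _ , αg≡αe , βg∈) with βg∈P , βg∈Q ← x∈p∩q⁻ P Q βg∈
        with refl ← onlyP g αg≡αe βg∈P = βe∉Q βg∈Q

  -- Both `α e` and `α f` lie in N(P) ∩ N(Q), but neither is a neighbour of P ∩ Q without the common
  -- end c. If b were missed, these two extra vertices would exceed the slack.
  tight-cover : ∀ {e f P Q b} → Heavy (β e) → β e ≡ β f → α e ≢ α f → Tight e P → Tight f Q →
                b ∈ₛ B → b ∈ₛ P ⊎ b ∈ₛ Q
  tight-cover {e} {f} {P} {Q} {b} heavy βe≡βf αe≢αf
    tightP@(βe∈P , P⊆B , _ , onlyP) tightQ@(βf∈Q , _ , _ , onlyQ) b∈B with b ∈? P ∪ Q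
  ... | yes b∈ = x∈p∪q⁻ P Q b∈
  ... | no  b∉ = contradiction (proper-∪⇒∣N∩N∣≤ tightP tightQ (b , b∈B , b∉)) (<⇒≱ (begin
    suc (suc ∣ P ∩ Q ∣)                              ≤⟨ s≤s (s≤s bound) ⟩
    suc (suc ∣ N ⊤ P ∩ N ⊤ Q - α e - α f ∣)          ≤⟨ s≤s (x∈p⇒∣p-x∣<∣p∣
                                                          (x∈p∧x≢y⇒x∈p-y αf∈N∩N (αe≢αf ∘ sym))) ⟩
    suc ∣ N ⊤ P ∩ N ⊤ Q - α e ∣                      ≤⟨ x∈p⇒∣p-x∣<∣p∣ αe∈N∩N ⟩
    ∣ N ⊤ P ∩ N ⊤ Q ∣                                ∎))
    where
    open ≤-Reasoning
    c : V
    c = β e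
    c∈Q : c ∈ₛ Q
    c∈Q = subst (_∈ₛ Q) (sym βe≡βf) βf∈Q
    αe∈N∩N : α e ∈ₛ N ⊤ P ∩ N ⊤ Q
    αe∈N∩N = x∈p∩q⁺ (∈-N⁺ ⊤ P ∈⊤ βe∈P , ∈-N⁺ ⊤ Q ∈⊤ c∈Q)
    αf∈N∩N : α f ∈ₛ N ⊤ P ∩ N ⊤ Q
    αf∈N∩N = x∈p∩q⁺ (∈-N⁺ ⊤ P ∈⊤ (subst (_∈ₛ P) βe≡βf βe∈P) , ∈-N⁺ ⊤ Q ∈⊤ βf∈Q)
    remove₂ : ∀ {x} → x ∈ₛ N ⊤ P ∩ N ⊤ Q → x ≢ α e → x ≢ α f → x ∈ₛ N ⊤ P ∩ N ⊤ Q - α e - α f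
    remove₂ x∈ x≢αe x≢αf = x∈p∧x≢y⇒x∈p-y (x∈p∧x≢y⇒x∈p-y x∈ x≢αe) x≢αf
    bound : ∣ P ∩ Q ∣ ≤ ∣ N ⊤ P ∩ N ⊤ Q - α e - α f ∣
    bound with nonempty? (P ∩ Q - c)
    -- When c is the whole intersection, a third edge at c supplies a common neighbour other than
    -- `α e` and `α f`.
    ... | no ¬ne with g , c~g , g≢e , g≢f ← third G heavy e f =
      ≤-trans (∣p∣≤1+∣p-x∣ (P ∩ Q) c)
     (≤-trans (s≤s (≤-reflexive (trans (cong ∣_∣ (Empty-unique ¬ne)) (∣⊥∣≡0 (order G)))))
     (x∈p⇒0<∣p∣ (remove₂ (x∈p∩q⁺ ( ∈-N⁺ ⊤ P ∈⊤ (subst (_∈ₛ P) c≡βg βe∈P)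
                                 , ∈-N⁺ ⊤ Q ∈⊤ (subst (_∈ₛ Q) c≡βg c∈Q)))
       (λ αg≡αe → g≢e (onlyP g αg≡αe (subst (_∈ₛ P) c≡βg βe∈P)))
       (λ αg≡αf → g≢f (onlyQ g αg≡αf (subst (_∈ₛ Q) c≡βg c∈Q))))))
      where
      c≡βg : c ≡ β g
      c≡βg = incident-B (β∈B e) c~g
    ... | yes ne = ≤-trans (∣p∣≤1+∣p-x∣ (P ∩ Q) c) (≤-trans
      (surplus ((λ x∈ → P⊆B (p∩q⊆p P Q (x∈p-y⇒x∈p (P ∩ Q) x∈))) , ne ,
                c , β∈B e , λ c∈ → x∈p-y⇒x≢y (P ∩ Q) c∈ refl))
      (p⊆q⇒∣p∣≤∣q∣ (N⊆ ⊤ (P ∩ Q - c) λ {g} _ βg∈ →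
        let βg∈∩ = x∈p-y⇒x∈p (P ∩ Q) βg∈
            βg≢c = x∈p-y⇒x≢y (P ∩ Q) βg∈
            βg∈P , βg∈Q = x∈p∩q⁻ P Q βg∈∩ in
        remove₂ (x∈p∩q⁺ (∈-N⁺ ⊤ P ∈⊤ βg∈P , ∈-N⁺ ⊤ Q ∈⊤ βg∈Q))
          (λ αg≡αe → βg≢c (cong β (onlyP g αg≡αe βg∈P)))
          (λ αg≡αf → βg≢c (trans (cong β (onlyQ g αg≡αf βg∈Q)) (sym βe≡βf))))))

  abstract
    -- Minimality excludes the absence of tight sets, and decidability turns this into an actual one
    -- to start from. Being `abstract`, the search is never unfolded.
    greatestTight : ∀ e → ∃ λ Q → Tight e Q × (∀ {P} → Tight e P → P ⊆ₛ Q)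
    greatestTight e = ∪-closed⇒greatest (tight? e)
      (decidable-stable (anySubset? (tight? e))
        (λ ¬tight → proj₂ minimal e (¬tight⇒-ₑ-matchingCovered e ¬tight)))
      tight-∪

  branch : E → VertexSet
  branch e = proj₁ (greatestTight e)

  branch-tight : ∀ e → Tight e (branch e)
  branch-tight e = proj₁ (proj₂ (greatestTight e))

  branch-greatest : ∀ {e P} → Tight e P → P ⊆ₛ branch e
  branch-greatest {e} = proj₂ (proj₂ (greatestTight e))

  β∈branch : ∀ e → β e ∈ₛ branch e
  β∈branch e = proj₁ (branch-tight e)

  branch⊆B : ∀ e → branch e ⊆ₛ B
  branch⊆B e = proj₁ (proj₂ (branch-tight e))

  branch-only : ∀ {e f} → α f ≡ α e → β f ∈ₛ branch e → f ≡ e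
  branch-only {e} = proj₂ (proj₂ (proj₂ (branch-tight e))) _

  -- A parallel copy of e would be a second edge from `α e` into the branch of e.
  simple : ∀ {e f} → α e ≡ α f → β e ≡ β f → e ≡ f
  simple {e} {f} αe≡αf βe≡βf = sym (branch-only (sym αe≡αf) (subst (_∈ₛ branch e) βe≡βf (β∈branch e)))

  -- The inclusion is proper because the end shared by f and g cannot lie in the branch of e: e is
  -- the only edge from `α e` into it.
  branch-nested : ∀ {e f g} → Heavy (α e) → α e ≡ α f → e ≢ f → β f ≡ β g → f ≢ g →
                  branch e ⊂ branch g
  branch-nested {e} {f} {g} heavy αe≡αf e≢f βf≡βg f≢g =
    (λ {_} → ⊆g) , β g , β∈branch g , λ βg∈ → βf∉ (subst (_∈ₛ branch e) (sym βf≡βg) βg∈)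
    where
    αf≢αg : α f ≢ α g
    αf≢αg αf≡αg = f≢g (simple αf≡αg βf≡βg)
    βf∉ : β f ∉ₛ branch e
    βf∉ βf∈ = e≢f (sym (branch-only (sym αe≡αf) βf∈))
    ⊆g : branch e ⊆ₛ branch g
    ⊆g {y} y∈ with heavy? (β f)
    ... | yes heavy-β with tight-cover heavy-β βf≡βg αf≢αg (branch-tight f) (branch-tight g) (branch⊆B e y∈)
    ...   | inj₂ y∈g = y∈g
    -- An edge h at a common vertex of the branches of e and f must start at `α e`, and would then
    -- equal both e and f.
    ...   | inj₁ y∈f with h , refl ← edgeAt-β (branch⊆B e y∈) =
            contradiction (trans (sym (branch-only αh≡αe y∈)) (branch-only (trans αh≡αe αe≡αf) y∈f)) e≢f
      where
      αh≡αe : α h ≡ α e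
      αh≡αe = N-tight-disjoint heavy αe≡αf e≢f (branch-tight e) (branch-tight f)
                (∈-N⁺ ⊤ (branch e) ∈⊤ y∈) (∈-N⁺ ⊤ (branch f) ∈⊤ y∈f)
    -- Here f and g are the only edges at `β f`. Adding this vertex to the branch of e thus adds at
    -- most the neighbour `α g`, and the enlarged set W is tight for g.
    ⊆g {y} y∈ | no light = branch-greatest tight (p⊆p∪q ⁅ β g ⁆ y∈)
      where
      W : VertexSet
      W = branch e ∪ ⁅ β g ⁆
      W⊆B : W ⊆ₛ B
      W⊆B x∈ with x∈p∪q⁻ (branch e) _ x∈
      ... | inj₁ x∈e = branch⊆B e x∈e
      ... | inj₂ x∈g = ⁅⁆⊆B (β∈B g) x∈g
      ends-W : ∀ {h} → β h ∈ₛ W → β h ∈ₛ branch e ⊎ h ≡ f ⊎ h ≡ g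
      ends-W {h} βh∈ with x∈p∪q⁻ (branch e) _ βh∈
      ... | inj₁ βh∈e = inj₁ βh∈e
      ... | inj₂ βh∈g = inj₂ (no-third G light (incident-β f)
              (subst (λ v → Incident G v g) (sym βf≡βg) (incident-β g))
              (subst (λ v → Incident G v h) (trans (x∈⁅y⁆⇒x≡y (β g) βh∈g) (sym βf≡βg)) (incident-β h)) f≢g)
      N⊆′ : N ⊤ W ⊆ₛ N ⊤ (branch e) ∪ ⁅ α g ⁆
      N⊆′ = N⊆ ⊤ W λ _ βh∈ → step (ends-W βh∈)
        where
        step : ∀ {h} → β h ∈ₛ branch e ⊎ h ≡ f ⊎ h ≡ g → α h ∈ₛ N ⊤ (branch e) ∪ ⁅ α g ⁆
        step (inj₁ βh∈e)         = x∈p∪q⁺ (inj₁ (∈-N⁺ ⊤ (branch e) ∈⊤ βh∈e))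
        step (inj₂ (inj₁ refl))  = x∈p∪q⁺ (inj₁ (subst (_∈ₛ N ⊤ (branch e)) αe≡αf
                                     (∈-N⁺ ⊤ (branch e) ∈⊤ (β∈branch e))))
        step (inj₂ (inj₂ refl))  = x∈p∪q⁺ (inj₂ (x∈⁅x⁆ (α g)))
      tight : Tight g W
      tight = q⊆p∪q (branch e) _ (x∈⁅x⁆ (β g)) , W⊆B , small , λ h αh≡αg βh∈ → only αh≡αg (ends-W βh∈)
        where
        open ≤-Reasoning
        small : ∣ N ⊤ W ∣ ≤ suc ∣ W ∣
        small = begin
          ∣ N ⊤ W ∣                      ≤⟨ p⊆q⇒∣p∣≤∣q∣ N⊆′ ⟩
          ∣ N ⊤ (branch e) ∪ ⁅ α g ⁆ ∣   ≤⟨ ∣p∪⁅x⁆∣≤1+∣p∣ (N ⊤ (branch e)) (α g) ⟩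
          suc ∣ N ⊤ (branch e) ∣         ≤⟨ s≤s (proj₁ (proj₂ (proj₂ (branch-tight e)))) ⟩
          suc (suc ∣ branch e ∣)         ≤⟨ s≤s (p⊂q⇒∣p∣<∣q∣ (x∈q∧x∉p⇒p⊂p∪q (x∈⁅x⁆ (β g))
                                              λ βg∈ → βf∉ (subst (_∈ₛ branch e) (sym βf≡βg) βg∈))) ⟩
          suc ∣ W ∣                      ∎
        only : ∀ {h} → α h ≡ α g → β h ∈ₛ branch e ⊎ h ≡ f ⊎ h ≡ g → h ≡ g
        -- An edge from `α g` into the branch of e would make `α g` a common neighbour of the
        -- branches of e and f, hence equal to `α e`.
        only αh≡αg (inj₁ βh∈e)        = contradiction
          (N-tight-disjoint heavy αe≡αf e≢f (branch-tight e) (branch-tight f)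
            (subst (_∈ₛ N ⊤ (branch e)) αh≡αg (∈-N⁺ ⊤ (branch e) ∈⊤ βh∈e))
            αg∈)
          (λ αg≡αe → αf≢αg (sym (trans αg≡αe αe≡αf)))
          where
          αg∈ : α g ∈ₛ N ⊤ (branch f)
          αg∈ = ∈-N⁺ ⊤ (branch f) ∈⊤ (subst (_∈ₛ branch f) βf≡βg (β∈branch f))
        only αh≡αg (inj₂ (inj₁ refl)) = contradiction αh≡αg αf≢αg
        only αh≡αg (inj₂ (inj₂ refl)) = refl

  branch-nested-size : ∀ {e f g} → Heavy (α e) → α e ≡ α f → e ≢ f → β f ≡ β g → f ≢ g →
                       ∣ branch e ∣ < ∣ branch g ∣
  branch-nested-size heavy αe≡αf e≢f βf≡βg f≢g =
    p⊂q⇒∣p∣<∣q∣ (branch-nested heavy αe≡αf e≢f βf≡βg f≢g)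

  -- In a perfect matching through e, some x in N(branch e) has its partner outside the branch of e,
  -- by surplus. If that partner lay in another branch at `α e`, then x would be `α e`, whose
  -- partner `β e` is inside.
  uncovered : ∀ e → Heavy (α e) → ∃ λ b → b ∈ₛ B × (∀ f → α f ≡ α e → b ∉ₛ branch f)
  uncovered e heavy = let M , pm , e∈M = matchingThrough e in unmatched pm e∈M
    where
    unmatched : ∀ {M} → PerfectMatching G M → e ∈ₛ M →
                ∃ λ b → b ∈ₛ B × (∀ f → α f ≡ α e → b ∉ₛ branch f)
    unmatched pm e∈M = found (any? λ x → (x ∈? N ⊤ (branch e)) ×-dec ¬? (β (μ x) ∈? branch e))
      where
      open Matching pm
      proper : Proper (branch e)
      proper = (λ {_} → branch⊆B e) , (β e , β∈branch e) ,
        (let f , f≢e , αf≡αe = another-α e in β f , β∈B f , λ βf∈ → f≢e (branch-only αf≡αe βf∈))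
      found : Dec (∃ λ x → x ∈ₛ N ⊤ (branch e) × β (μ x) ∉ₛ branch e) →
              ∃ λ b → b ∈ₛ B × (∀ f → α f ≡ α e → b ∉ₛ branch f)
      found (no none) = contradiction (surplus proper) (≤⇒≯
        (injectiveOn⇒∣p∣≤∣q∣ (N ⊤ (branch e)) (β ∘ μ)
          (λ {x} x∈ → decidable-stable (β (μ x) ∈? branch e) λ ∉ → none (x , x∈ , ∉))
          (λ x∈ y∈ → β∘μ-injective (N⊆A ⊤ (branch e) x∈) (N⊆A ⊤ (branch e) y∈))))
      found (yes (x , x∈N , ∉)) = β (μ x) , β∈B (μ x) , avoid
        where
        avoid : ∀ f → α f ≡ α e → β (μ x) ∉ₛ branch f
        avoid f αf≡αe ∈f = ∉ (subst (λ h → β h ∈ₛ branch e) (sym μx≡e) (β∈branch e))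
          where
          e≢f : e ≢ f
          e≢f refl = ∉ ∈f
          x∈N′ : x ∈ₛ N ⊤ (branch f)
          x∈N′ = subst (_∈ₛ N ⊤ (branch f)) (α-μ (N⊆A ⊤ (branch e) x∈N)) (∈-N⁺ ⊤ (branch f) ∈⊤ ∈f)
          x≡αe : x ≡ α e
          x≡αe = N-tight-disjoint heavy (sym αf≡αe) e≢f (branch-tight e) (branch-tight f) x∈N x∈N′
          μx≡e : μ x ≡ e
          μx≡e = trans (cong μ x≡αe) (μ-unique e∈M (incident-α e))

  -- The forest of parents and children

  abstract
    parent : ∀ v → ∃ λ e → Incident G v e × (∀ {f} → Incident G v f → ∣ branch f ∣ ≤ ∣ branch e ∣)
    parent v =
      let e , v~e , least = minimum (incident? G v) φ (edgeAt v)
      in  e , v~e , λ {f} v~f → ≮⇒≥ λ lt → <⇒≱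
            (∸-monoʳ-< {order G} {∣ branch f ∣} {∣ branch e ∣} lt (∣p∣≤n (branch f))) (least {f} v~f)
      where
      φ : E → ℕ
      -- Taking complements makes `minimum` pick a largest branch.
      φ e = order G ℕ.∸ ∣ branch e ∣

  p : V → E
  p v = proj₁ (parent v)

  α-p : ∀ {v} → v ∈ₛ A → α (p v) ≡ v
  α-p v∈A = sym (incident-A v∈A (proj₁ (proj₂ (parent _))))

  αp≡α : ∀ f → α (p (α f)) ≡ α f
  αp≡α f = α-p (α∈A f)

  p-greatest : ∀ f → ∣ branch f ∣ ≤ ∣ branch (p (α f)) ∣
  p-greatest f = proj₂ (proj₂ (parent (α f))) (incident-α f)

  -- The edges at heavy vertices form a forest; p v leads from v to its parent in B
  -- and the other edges at v lead to its children.
  Child : E → Set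
  Child f = Heavy (α f) × f ≢ p (α f)

  child? : ∀ f → Dec (Child f)
  child? f = heavy? (α f) ×-dec ¬? (f ≟ p (α f))

  Root : V → Set
  Root b = ∀ {f} → Child f → β f ≢ b

  -- The nesting with the parent edge of `α f` in the first place. Along the forest, branches of
  -- parent edges grow strictly downwards, so climbing towards a root terminates.
  child-step : ∀ {f g} → Child f → β f ≡ β g → f ≢ g → ∣ branch (p (α f)) ∣ < ∣ branch g ∣
  child-step {f} (heavy , f≢p) βf≡βg f≢g =
    branch-nested-size (subst Heavy (sym (αp≡α f)) heavy) (αp≡α f) (f≢p ∘ sym) βf≡βg f≢g

  -- If f and g met in B, the branch of f would be no larger than that of the parent edge at `α f`,
  -- which is smaller than that of g; by symmetry the reverse would hold too.
  child-β-injective : ∀ {f g} → Child f → Child g → β f ≡ β g → f ≡ g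
  child-β-injective {f} {g} child-f child-g βf≡βg = decidable-stable (f ≟ g) λ f≢g →
    <-asym (≤-<-trans (p-greatest f) (child-step child-f βf≡βg f≢g))
           (≤-<-trans (p-greatest g) (child-step child-g (sym βf≡βg) (f≢g ∘ sym)))

  not-own-child : ∀ {f v} → v ∈ₛ A → Child f → f ≢ p v
  not-own-child {f} v∈A (_ , f≢p) refl = f≢p (cong p (sym (α-p v∈A)))

  -- If the parent of `α f` is itself the end of a child edge h, the branch of f is nested in that
  -- of h, so b stays inside while the height drops.
  ascend : ∀ {b} f → Child f → b ∈ₛ branch f →
           ∃ λ g → Child g × b ∈ₛ branch g × Root (β (p (α g)))
  ascend {b} f child-f b∈ = go f child-f b∈ (<-wellFounded (height f))
    where
    height : E → ℕ
    height f = ∣ branch (p (α f)) ∣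
    go : ∀ f → Child f → b ∈ₛ branch f → Acc _<_ (height f) →
         ∃ λ g → Child g × b ∈ₛ branch g × Root (β (p (α g)))
    go f child-f b∈ (acc rec) = step (any? λ h → child? h ×-dec (β h ≟ β (p (α f))))
      where
      step : Dec (∃ λ h → Child h × β h ≡ β (p (α f))) →
             ∃ λ g → Child g × b ∈ₛ branch g × Root (β (p (α g)))
      step (no none) = f , child-f , b∈ , λ {h} child-h βh≡ → none (h , child-h , βh≡)
      step (yes (h , child-h , βh≡)) = go h child-h (proj₁ nested b∈) (rec (child-step child-h βh≡ h≢p))
        where
        h≢p : h ≢ p (α f)
        h≢p = not-own-child (α∈A f) child-h
        nested : branch f ⊂ branch h
        nested = branch-nested (proj₁ child-f) (sym (αp≡α f)) (proj₂ child-f) (sym βh≡) (h≢p ∘ sym)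

  -- One root is the parent of a heavy vertex a whose parent branch is smallest. The other comes
  -- from a vertex b outside all branches at a: either b itself or the root reached by ascending
  -- from b.
  two-roots : (∃ λ v → v ∈ₛ A × Heavy v) →
              ∃ λ u → ∃ λ w → u ≢ w × u ∈ₛ B × w ∈ₛ B × Root u × Root w
  two-roots heavyVertex =
    let a , (a∈A , heavy) , least =
          minimum (λ v → (v ∈? A) ×-dec heavy? v) (λ v → ∣ branch (p v) ∣) heavyVertex
    in  fromLeast (p a) a∈A (α-p a∈A) refl heavy least
    where
    fromLeast : ∀ {a} e → a ∈ₛ A → α e ≡ a → e ≡ p a → Heavy a →
      (∀ {v} → v ∈ₛ A × Heavy v → ∣ branch (p a) ∣ ≤ ∣ branch (p v) ∣) →
      ∃ λ u → ∃ λ w → u ≢ w × u ∈ₛ B × w ∈ₛ B × Root u × Root w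
    fromLeast e a∈A refl e≡p heavy least =
      let b , b∈B , b∉ = uncovered e heavy in fromUncovered b b∈B b∉ (any? λ f → child? f ×-dec (β f ≟ b))
      where
      -- A child edge ending here would start at a heavy vertex with a smaller parent branch.
      root-e : Root (β e)
      root-e {f} child-f βf≡βe = <⇒≱
        (child-step child-f βf≡βe λ f≡e →
          proj₂ child-f (trans f≡e (trans e≡p (cong (p ∘ α) (sym f≡e)))))
        (subst (λ g → ∣ branch g ∣ ≤ _) (sym e≡p) (least (α∈A f , proj₁ child-f)))
      fromUncovered : ∀ b → b ∈ₛ B → (∀ f → α f ≡ α e → b ∉ₛ branch f) →
        Dec (∃ λ f → Child f × β f ≡ b) →
        ∃ λ u → ∃ λ w → u ≢ w × u ∈ₛ B × w ∈ₛ B × Root u × Root w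
      fromUncovered b b∈B b∉ (no none) =
        b , β e , (λ b≡βe → b∉ e refl (subst (_∈ₛ branch e) (sym b≡βe) (β∈branch e))) , b∈B , β∈B e ,
        (λ {f} child-f βf≡b → none (f , child-f , βf≡b)) , λ {_} → root-e
      fromUncovered b b∈B b∉ (yes (f , child-f , βf≡b)) =
        let g , child-g , b∈g , root = ascend f child-f (subst (_∈ₛ branch f) βf≡b (β∈branch f))
        in  β (p (α g)) , β e , distinct child-g b∈g , β∈B (p (α g)) , β∈B e , (λ {_} → root) , λ {_} → root-e
        where
        -- If the roots coincided, the branch of g would be nested in that of e, which does not
        -- contain b.
        distinct : ∀ {g} → Child g → b ∈ₛ branch g → β (p (α g)) ≢ β e
        distinct {g} child-g b∈g eq = b∉ e refl (proj₁
          (branch-nested (proj₁ child-g) (sym (αp≡α g)) (proj₂ child-g) eq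
            (λ pg≡e → b∉ g (trans (sym (αp≡α g)) (cong α pg≡e)) b∈g)) b∈g)

-- Edge extremal graphs

injective⇒surjective : ∀ {n} (f : Fin n → Fin n) → (∀ {x y} → f x ≡ f y → x ≡ y) → ∀ y → ∃ λ x → f x ≡ y
injective⇒surjective {n} f injective y = decidable-stable (any? λ x → f x ≟ y) λ none →
  <⇒≱ (x∈p⇒∣p-x∣<∣p∣ (∈⊤ {x = y}))
      (injectiveOn⇒∣p∣≤∣q∣ ⊤ f (λ {x} _ → x∈p∧x≢y⇒x∈p-y ∈⊤ λ fx≡y → none (x , fx≡y)) (λ _ _ → injective))

-- The forward map is the inverse of f: labellings run from the hexagon to G, while the isomorphism
-- runs from G to `C₆`.
injective⇒permutation : ∀ {n} (f : Fin n → Fin n) → (∀ {x y} → f x ≡ f y → x ≡ y) → Permutation n n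
injective⇒permutation f injective = permutation (λ y → proj₁ (surjective y)) f
  (λ x → injective (proj₂ (surjective (f x)))) (λ y → proj₂ (surjective y))
  where surjective = injective⇒surjective f injective

hexagon⇒≅C₆ : (G : Graph) → order G ≡ 6 → size G ≡ 6 →
  (g : Fin 6 → Vertex G) (h : Fin 6 → Edge G) →
  (∀ {i j} → g i ≡ g j → i ≡ j) → (∀ {i j} → h i ≡ h j → i ≡ j) →
  (∀ i → Joins G (h i) (g i) (g (suc (toℕ i) mod 6))) → G ≅ C₆
hexagon⇒≅C₆ G@(graph .6 .6 ends _) refl refl g h g-injective h-injective h-joins = record
  { onVertices = injective⇒permutation g g-injective
  ; onEdges    = injective⇒permutation h h-injective
  ; preserves  = preserves
  }
  where
  g⁻¹ h⁻¹ : Fin 6 → Fin 6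
  g⁻¹ u = proj₁ (injective⇒surjective g g-injective u)
  h⁻¹ e = proj₁ (injective⇒surjective h h-injective e)
  g⁻¹-g : ∀ i → g⁻¹ (g i) ≡ i
  g⁻¹-g i = g-injective (proj₂ (injective⇒surjective g g-injective (g i)))
  h-h⁻¹ : ∀ e → h (h⁻¹ e) ≡ e
  h-h⁻¹ e = proj₂ (injective⇒surjective h h-injective e)

  pull-back : ∀ {i j u v} → (g i , g j) ≡ (u , v) → (i , j) ≡ (g⁻¹ u , g⁻¹ v)
  pull-back refl = sym (cong₂ _,_ (g⁻¹-g _) (g⁻¹-g _))

  preserves-h : ∀ i {j u v} → Joins G (h i) (g i) (g j) → Joins G (h i) u v →
                (i , j) ≡ (g⁻¹ u , g⁻¹ v) ⊎ (i , j) ≡ (g⁻¹ v , g⁻¹ u)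
  preserves-h i (inj₁ p) (inj₁ q) = inj₁ (pull-back (trans (sym p) q))
  preserves-h i (inj₁ p) (inj₂ q) = inj₂ (pull-back (trans (sym p) q))
  preserves-h i (inj₂ p) (inj₁ q) = inj₂ (pull-back (cong swap (trans (sym p) q)))
  preserves-h i (inj₂ p) (inj₂ q) = inj₁ (pull-back (cong swap (trans (sym p) q)))

  preserves : ∀ e u v → Joins G e u v → Joins C₆ (h⁻¹ e) (g⁻¹ u) (g⁻¹ v)
  preserves e u v j = preserves-h (h⁻¹ e) (h-joins (h⁻¹ e)) (subst (λ e → Joins G e u v) (sym (h-h⁻¹ e)) j)

-- Counting edges by parent and nonparent edges

module Counting (G : Graph) (side : Vertex G → Bool)
                (bipartite : ∀ e → side (proj₁ (ends G e)) ≢ side (proj₂ (ends G e)))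
                (minimal : MinimalMatchingCovered G)
                (extremal : 2 * size G + 6 ≡ 3 * order G) where

  open Minimal G side bipartite minimal public

  private
    V = Vertex G
    E = Edge G

  isParent? : ∀ e → Dec (e ≡ p (α e))
  isParent? e = e ≟ p (α e)

  parents nonparents : Subset (size G)
  parents = subset isParent?
  nonparents = subset (¬? ∘ isParent?)

  size≤ : size G ≤ ∣ parents ∣ + ∣ nonparents ∣
  size≤ = begin
    size G                                              ≡⟨ ∣⊤∣≡n (size G) ⟨
    ∣ ⊤ {size G} ∣                                      ≤⟨ p⊆q⇒∣p∣≤∣q∣ {p = ⊤} {parents ∪ nonparents} (λ {e} _ → split e) ⟩
    ∣ parents ∪ nonparents ∣                            ≤⟨ m≤m+n _ _ ⟩
    ∣ parents ∪ nonparents ∣ + ∣ parents ∩ nonparents ∣ ≡⟨ ∣∪∣+∣∩∣ parents nonparents ⟩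
    ∣ parents ∣ + ∣ nonparents ∣                        ∎
    where
    open ≤-Reasoning
    split : ∀ e → e ∈ₛ parents ∪ nonparents
    split e with e ≟ p (α e)
    ... | yes e≡p = x∈p∪q⁺ (inj₁ (∈-subset⁺ isParent? e≡p))
    ... | no  e≢p = x∈p∪q⁺ (inj₂ (∈-subset⁺ (¬? ∘ isParent?) e≢p))

  ≤size : ∣ parents ∣ + ∣ nonparents ∣ ≤ size G
  ≤size = begin
    ∣ parents ∣ + ∣ nonparents ∣                        ≡⟨ ∣∪∣+∣∩∣ parents nonparents ⟨
    ∣ parents ∪ nonparents ∣ + ∣ parents ∩ nonparents ∣ ≡⟨ cong (λ q → ∣ parents ∪ nonparents ∣ + ∣ q ∣)
                                                             (Empty-unique empty) ⟩
    ∣ parents ∪ nonparents ∣ + ∣ ⊥ {size G} ∣           ≡⟨ cong (∣ parents ∪ nonparents ∣ +_) (∣⊥∣≡0 (size G)) ⟩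
    ∣ parents ∪ nonparents ∣ + 0                        ≡⟨ +-identityʳ _ ⟩
    ∣ parents ∪ nonparents ∣                            ≤⟨ ∣p∣≤n (parents ∪ nonparents) ⟩
    size G                                              ∎
    where
    open ≤-Reasoning
    empty : Empty (parents ∩ nonparents)
    empty (e , e∈) = let e∈p , e∈n = x∈p∩q⁻ parents nonparents e∈ in
      ∈-subset⁻ (¬? ∘ isParent?) e∈n (∈-subset⁻ isParent? e∈p)

  ∣parents∣≤∣A∣ : ∣ parents ∣ ≤ ∣ A ∣
  ∣parents∣≤∣A∣ = injectiveOn⇒∣p∣≤∣q∣ parents α (λ _ → α∈A _) λ e∈ f∈ αe≡αf →
    trans (∈-subset⁻ isParent? e∈) (trans (cong p αe≡αf) (sym (∈-subset⁻ isParent? f∈)))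

  ∣A∣≤∣parents∣ : ∣ A ∣ ≤ ∣ parents ∣
  ∣A∣≤∣parents∣ = injectiveOn⇒∣p∣≤∣q∣ A p
    (λ v∈A → ∈-subset⁺ isParent? (cong p (sym (α-p v∈A))))
    (λ u∈A v∈A pu≡pv → trans (sym (α-p u∈A)) (trans (cong α pu≡pv) (α-p v∈A)))

  ∣A∣≤∣nonparents∣ : ∣ A ∣ ≤ ∣ nonparents ∣
  ∣A∣≤∣nonparents∣ = injectiveOn⇒∣p∣≤∣q∣ A q
    (λ v∈A → ∈-subset⁺ (¬? ∘ isParent?) λ q≡p → proj₁ (proj₂ (another-α (p _)))
      (trans q≡p (cong p (α-q v∈A))))
    (λ u∈A v∈A qu≡qv → trans (sym (α-q u∈A)) (trans (cong α qu≡qv) (α-q v∈A)))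
    where
    q : V → E
    q v = proj₁ (another-α (p v))
    α-q : ∀ {v} → v ∈ₛ A → α (q v) ≡ v
    α-q v∈A = trans (proj₂ (proj₂ (another-α (p _)))) (α-p v∈A)

  ∣A∣+∣A∣≡n : ∣ A ∣ + ∣ A ∣ ≡ order G
  ∣A∣+∣A∣≡n = trans (cong (∣ A ∣ +_) ∣A∣≡∣B∣) ∣A∣+∣B∣≡n

  order≤size : order G ≤ size G
  order≤size = begin
    order G                      ≡⟨ ∣A∣+∣A∣≡n ⟨
    ∣ A ∣ + ∣ A ∣                ≤⟨ +-mono-≤ ∣A∣≤∣parents∣ ∣A∣≤∣nonparents∣ ⟩
    ∣ parents ∣ + ∣ nonparents ∣ ≤⟨ ≤size ⟩
    size G                       ∎
    where open ≤-Reasoning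

  light-nonparents : ∀ {e f} → ¬ Heavy (α e) → e ≢ p (α e) → f ≢ p (α f) → α e ≡ α f → e ≡ f
  light-nonparents {e} {f} light e≢p f≢p αe≡αf = decidable-stable (e ≟ f) λ e≢f →
    clash (no-third G light (proj₁ (proj₂ (parent (α e)))) (incident-α e)
      (subst (λ v → Incident G v f) (sym αe≡αf) (incident-α f)) (e≢p ∘ sym)) e≢f
    where
    clash : f ≡ p (α e) ⊎ f ≡ e → e ≢ f → Empty.⊥
    clash (inj₁ f≡p) _   = f≢p (trans f≡p (cong p αe≡αf))
    clash (inj₂ f≡e) e≢f = e≢f (sym f≡e)

  no-heavy⇒size≤order : (∀ {v} → v ∈ₛ A → ¬ Heavy v) → size G ≤ order G
  no-heavy⇒size≤order light = begin
    size G                       ≤⟨ size≤ ⟩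
    ∣ parents ∣ + ∣ nonparents ∣ ≤⟨ +-mono-≤ ∣parents∣≤∣A∣ (injectiveOn⇒∣p∣≤∣q∣ nonparents α (λ _ → α∈A _)
      λ e∈ f∈ → light-nonparents (light (α∈A _))
        (∈-subset⁻ (¬? ∘ isParent?) e∈) (∈-subset⁻ (¬? ∘ isParent?) f∈)) ⟩
    ∣ A ∣ + ∣ A ∣                ≡⟨ ∣A∣+∣A∣≡n ⟩
    order G                      ∎
    where open ≤-Reasoning

  -- If every vertex of A has degree two, then m = n, and 2m + 6 = 3n leaves only n = 6.
  no-heavy⇒hexagonal : (∀ {v} → v ∈ₛ A → ¬ Heavy v) → order G ≡ 6 × size G ≡ 6
  no-heavy⇒hexagonal light = n≡6 , trans size≡order n≡6
    where
    size≡order : size G ≡ order G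
    size≡order = ≤-antisym (no-heavy⇒size≤order light) order≤size
    n≡6 : order G ≡ 6
    n≡6 = sym (+-cancelˡ-≡ (2 * order G) 6 (order G)
      (trans (trans (cong (λ k → 2 * k + 6) (sym size≡order)) extremal) (+-comm (order G) (2 * order G))))

  -- Send a nonparent edge to its B-end if its A-end is heavy, and to its A-end otherwise. This is
  -- injective and avoids a, c and two roots, so m ≤ n/2 + n - 4, whereas extremality says m = 3n/2
  -- - 3.
  heavy-unique : ∀ {a c} → a ∈ₛ A → c ∈ₛ A → Heavy a → Heavy c → a ≡ c
  heavy-unique {a} {c} a∈A c∈A heavy-a heavy-c = decidable-stable (a ≟ c) λ a≢c →
    let u , w , u≢w , u∈B , w∈B , root-u , root-w = two-roots (a , a∈A , heavy-a)
    in  bound a≢c u≢w u∈B w∈B root-u root-w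
    where
    -- The decision is an argument so that the lemmas on `target` can split on it.
    target : ∀ f → Dec (Heavy (α f)) → V
    target f (yes _) = β f
    target f (no  _) = α f

    A≢B : ∀ {u v} → u ∈ₛ A → v ∈ₛ B → u ≢ v
    A≢B u∈A v∈B refl = A-∉-B u∈A v∈B

    bound : ∀ {u w} → a ≢ c → u ≢ w → u ∈ₛ B → w ∈ₛ B → Root u → Root w → Empty.⊥
    bound {u} {w} a≢c u≢w u∈B w∈B root-u root-w = <⇒≱ (s≤s (n≤1+n _)) (begin
      2 + (2 * size G + 6)                          ≡⟨ solve 1 (λ m →
          con 2 :+ (con 2 :* m :+ con 6) := con 2 :* (m :+ con 4)) refl (size G) ⟩
      2 * (size G + 4)                              ≤⟨ *-monoʳ-≤ 2 (+-monoˡ-≤ 4 size≤) ⟩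
      2 * (∣ parents ∣ + ∣ nonparents ∣ + 4)        ≤⟨ *-monoʳ-≤ 2 (+-monoˡ-≤ 4 (+-mono-≤ ∣parents∣≤∣A∣ nonparents≤)) ⟩
      2 * (∣ A ∣ + ∣ T ∣ + 4)                       ≡⟨ solve 2 (λ x t →
          con 2 :* (x :+ t :+ con 4) := (x :+ x) :+ con 2 :* (con 4 :+ t)) refl ∣ A ∣ ∣ T ∣ ⟩
      ∣ A ∣ + ∣ A ∣ + 2 * (4 + ∣ T ∣)               ≤⟨ +-mono-≤ (≤-reflexive ∣A∣+∣A∣≡n) (*-monoʳ-≤ 2 T≤) ⟩
      3 * order G                                   ≡⟨ extremal ⟨
      2 * size G + 6                                ∎)
      where
      open ≤-Reasoning
      open ℕ.+-*-Solver
      T : Subset (order G)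
      T = ⊤ - a - c - u - w

      ∈T : ∀ {v} → v ≢ a → v ≢ c → v ≢ u → v ≢ w → v ∈ₛ T
      ∈T v≢a v≢c v≢u v≢w =
        x∈p∧x≢y⇒x∈p-y (x∈p∧x≢y⇒x∈p-y (x∈p∧x≢y⇒x∈p-y (x∈p∧x≢y⇒x∈p-y ∈⊤ v≢a) v≢c) v≢u) v≢w

      T≤ : 4 + ∣ T ∣ ≤ order G
      T≤ = begin
        4 + ∣ ⊤ - a - c - u - w ∣  ≤⟨ +-monoʳ-≤ 3 (x∈p⇒∣p-x∣<∣p∣ {x = w} (x∈p∧x≢y⇒x∈p-y (x∈p∧x≢y⇒x∈p-y
                                       (x∈p∧x≢y⇒x∈p-y ∈⊤ (A≢B a∈A w∈B ∘ sym)) (A≢B c∈A w∈B ∘ sym)) (u≢w ∘ sym))) ⟩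
        3 + ∣ ⊤ - a - c - u ∣      ≤⟨ +-monoʳ-≤ 2 (x∈p⇒∣p-x∣<∣p∣ {x = u} (x∈p∧x≢y⇒x∈p-y
                                       (x∈p∧x≢y⇒x∈p-y ∈⊤ (A≢B a∈A u∈B ∘ sym)) (A≢B c∈A u∈B ∘ sym))) ⟩
        2 + ∣ ⊤ - a - c ∣          ≤⟨ +-monoʳ-≤ 1 (x∈p⇒∣p-x∣<∣p∣ {x = c} (x∈p∧x≢y⇒x∈p-y ∈⊤ (a≢c ∘ sym))) ⟩
        1 + ∣ ⊤ - a ∣              ≤⟨ x∈p⇒∣p-x∣<∣p∣ {x = a} ∈⊤ ⟩
        ∣ ⊤ {order G} ∣            ≡⟨ ∣⊤∣≡n (order G) ⟩
        order G                    ∎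

      target∈T : ∀ {f} (d : Dec (Heavy (α f))) → f ≢ p (α f) → target f d ∈ₛ T
      target∈T {f} (yes heavy) f≢p = ∈T
        (A≢B a∈A (β∈B f) ∘ sym) (A≢B c∈A (β∈B f) ∘ sym) (root-u (heavy , f≢p)) (root-w (heavy , f≢p))
      target∈T {f} (no light) f≢p = ∈T
        (λ αf≡a → light (subst Heavy (sym αf≡a) heavy-a)) (λ αf≡c → light (subst Heavy (sym αf≡c) heavy-c))
        (A≢B (α∈A f) u∈B) (A≢B (α∈A f) w∈B)

      target-injective : ∀ {e f} (d : Dec (Heavy (α e))) (d′ : Dec (Heavy (α f))) →
        e ≢ p (α e) → f ≢ p (α f) → target e d ≡ target f d′ → e ≡ f
      target-injective (yes he) (yes hf) e≢p f≢p eq = child-β-injective (he , e≢p) (hf , f≢p) eq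
      target-injective (no  le) (no  _)  e≢p f≢p eq = light-nonparents le e≢p f≢p eq
      target-injective {e} {f} (yes _) (no _) _ _ eq = contradiction (sym eq) (A≢B (α∈A f) (β∈B e))
      target-injective {e} {f} (no _) (yes _) _ _ eq = contradiction eq (A≢B (α∈A e) (β∈B f))

      nonparents≤ : ∣ nonparents ∣ ≤ ∣ T ∣
      nonparents≤ = injectiveOn⇒∣p∣≤∣q∣ nonparents (λ f → target f (heavy? (α f)))
        (λ f∈ → target∈T (heavy? _) (∈-subset⁻ (¬? ∘ isParent?) f∈))
        (λ e∈ f∈ → target-injective (heavy? _) (heavy? _)
          (∈-subset⁻ (¬? ∘ isParent?) e∈) (∈-subset⁻ (¬? ∘ isParent?) f∈))

-- A hexagon is K₃,₃ minus a perfect matching: each vertex misses exactly one vertex of the other side.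
module Hexagonal (G : Graph) (side : Vertex G → Bool)
                 (bipartite : ∀ e → side (proj₁ (ends G e)) ≢ side (proj₂ (ends G e)))
                 (covered : MatchingCovered G)
                 (n≡6 : order G ≡ 6) (m≡6 : size G ≡ 6)
                 (light : ∀ {v} → side v ≡ false → ¬ 2 < degree G v) where

  open Covered G side bipartite covered

  private
    V = Vertex G
    E = Edge G

  ∣B∣≡3 : ∣ B ∣ ≡ 3
  ∣B∣≡3 = *-cancelˡ-≡ ∣ B ∣ 3 2 (begin
    2 * ∣ B ∣     ≡⟨ cong (∣ B ∣ +_) (+-identityʳ ∣ B ∣) ⟩
    ∣ B ∣ + ∣ B ∣ ≡⟨ cong (_+ ∣ B ∣) ∣A∣≡∣B∣ ⟨
    ∣ A ∣ + ∣ B ∣ ≡⟨ ∣A∣+∣B∣≡n ⟩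
    order G       ≡⟨ n≡6 ⟩
    6             ∎)
    where open ≡-Reasoning

  ∣A∣≡3 : ∣ A ∣ ≡ 3
  ∣A∣≡3 = trans ∣A∣≡∣B∣ ∣B∣≡3

  ∣N⁅⁆∣≤2 : ∀ {b} → b ∈ₛ B → ∣ N ⊤ ⁅ b ⁆ ∣ ≤ 2
  ∣N⁅⁆∣≤2 {b} b∈B = ≮⇒≥ λ 2<∣N∣ →
    let x , x∈         = 0<∣p∣⇒Nonempty (N ⊤ ⁅ b ⁆) (≤-trans (s≤s z≤n) 2<∣N∣)
        y , y∈ , y≢x   = 1<∣p∣⇒another (N ⊤ ⁅ b ⁆) (≤-trans (s≤s (s≤s z≤n)) 2<∣N∣) x
        z , z∈ , z≢x , z≢y = 2<∣p∣⇒another (N ⊤ ⁅ b ⁆) 2<∣N∣ x y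
    in  clash (∈-N⁻ ⊤ ⁅ b ⁆ x∈) (∈-N⁻ ⊤ ⁅ b ⁆ y∈) (∈-N⁻ ⊤ ⁅ b ⁆ z∈) y≢x z≢x z≢y
    where
    at : ∀ {e} → β e ∈ₛ ⁅ b ⁆ → Incident G b e
    at {e} βe∈ = subst (λ v → Incident G v e) (x∈⁅y⁆⇒x≡y b βe∈) (incident-β e)
    EdgeTo : V → Set
    EdgeTo x = ∃ λ e → e ∈ₛ ⊤ × α e ≡ x × β e ∈ₛ ⁅ b ⁆
    clash : ∀ {x y z} → EdgeTo x → EdgeTo y → EdgeTo z → y ≢ x → z ≢ x → z ≢ y → Empty.⊥
    clash (e , _ , refl , βe) (f , _ , refl , βf) (g , _ , refl , βg) y≢x z≢x z≢y
      with no-third G (light (∈-subset⁻ onB? b∈B)) (at βe) (at βf) (at βg) (λ e≡f → y≢x (cong α (sym e≡f)))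
    ... | inj₁ g≡e = z≢x (cong α g≡e)
    ... | inj₂ g≡f = z≢y (cong α g≡f)

  missing : ∀ {b} → b ∈ₛ B → ∃ λ a → a ∈ₛ A × a ∉ₛ N ⊤ ⁅ b ⁆
  missing {b} b∈B = decidable-stable (any? λ a → (a ∈? A) ×-dec ¬? (a ∈? N ⊤ ⁅ b ⁆)) λ none →
    <⇒≱ (≤-reflexive (sym ∣A∣≡3)) (≤-trans (p⊆q⇒∣p∣≤∣q∣ {q = N ⊤ ⁅ b ⁆} λ {a} a∈A →
      decidable-stable (a ∈? N ⊤ ⁅ b ⁆) λ a∉N → none (a , a∈A , a∉N)) (∣N⁅⁆∣≤2 b∈B))

  -- Surplus gives b at least two neighbours among the three vertices of A.
  missing-unique : ∀ {a c b} → b ∈ₛ B → a ∈ₛ A → c ∈ₛ A → a ∉ₛ N ⊤ ⁅ b ⁆ → c ≢ a → c ∈ₛ N ⊤ ⁅ b ⁆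
  missing-unique {a} {c} {b} b∈B a∈A c∈A a∉N c≢a = decidable-stable (c ∈? N ⊤ ⁅ b ⁆) λ c∉N →
    <⇒≱ (s≤s (s≤s (≤-reflexive (sym (∣⁅x⁆∣≡1 b))))) (begin
      suc (suc ∣ ⁅ b ⁆ ∣)     ≤⟨ s≤s (surplus (⁅⁆-proper b∈B)) ⟩
      suc ∣ N ⊤ ⁅ b ⁆ ∣       ≤⟨ s≤s (p⊆q⇒∣p∣≤∣q∣ {q = A - a - c} λ x∈ → x∈p∧x≢y⇒x∈p-y
                                  (x∈p∧x≢y⇒x∈p-y (N⊆A ⊤ ⁅ b ⁆ x∈) λ { refl → a∉N x∈ }) λ { refl → c∉N x∈ }) ⟩
      suc ∣ A - a - c ∣       ≤⟨ x∈p⇒∣p-x∣<∣p∣ (x∈p∧x≢y⇒x∈p-y c∈A c≢a) ⟩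
      ∣ A - a ∣               ≤⟨ s≤s⁻¹ (≤-trans (x∈p⇒∣p-x∣<∣p∣ a∈A) (≤-reflexive ∣A∣≡3)) ⟩
      2                       ∎)
    where open ≤-Reasoning

  -- Two vertices of B missing the same a would have only two neighbours together, against the
  -- surplus of the pair.
  missing-distinct : ∀ {a b c} → a ∈ₛ A → b ∈ₛ B → c ∈ₛ B → b ≢ c →
                     a ∉ₛ N ⊤ ⁅ b ⁆ → a ∉ₛ N ⊤ ⁅ c ⁆ → Empty.⊥
  missing-distinct {a} {b} {c} a∈A b∈B c∈B b≢c a∉Nb a∉Nc = <⇒≱ (surplus proper) (begin
    ∣ N ⊤ pair ∣  ≤⟨ p⊆q⇒∣p∣≤∣q∣ {q = A - a} (λ x∈ → x∈p∧x≢y⇒x∈p-y (N⊆A ⊤ pair x∈) λ { refl → a∉N x∈ }) ⟩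
    ∣ A - a ∣     ≤⟨ s≤s⁻¹ (≤-trans (x∈p⇒∣p-x∣<∣p∣ a∈A) (≤-reflexive ∣A∣≡3)) ⟩
    2             ≤⟨ distinct₂⇒1<∣p∣ (x∈p∪q⁺ (inj₁ (x∈⁅x⁆ b))) (x∈p∪q⁺ (inj₂ (x∈⁅x⁆ c))) b≢c ⟩
    ∣ pair ∣      ∎)
    where
    open ≤-Reasoning
    pair : Subset (order G)
    pair = ⁅ b ⁆ ∪ ⁅ c ⁆
    pair⊆B : pair ⊆ₛ B
    pair⊆B x∈ with x∈p∪q⁻ ⁅ b ⁆ _ x∈
    ... | inj₁ x∈b = ⁅⁆⊆B b∈B x∈b
    ... | inj₂ x∈c = ⁅⁆⊆B c∈B x∈c
    proper : Proper pair
    proper = (λ {_} → pair⊆B) , (b , x∈p∪q⁺ (inj₁ (x∈⁅x⁆ b))) ,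
      let d , d∈B , d≢b , d≢c = 2<∣p∣⇒another B (≤-reflexive (sym ∣B∣≡3)) b c
      in  d , d∈B , λ d∈ → d∉ d≢b d≢c (x∈p∪q⁻ ⁅ b ⁆ _ d∈)
      where
      d∉ : ∀ {d} → d ≢ b → d ≢ c → ¬ (d ∈ₛ ⁅ b ⁆ ⊎ d ∈ₛ ⁅ c ⁆)
      d∉ d≢b d≢c (inj₁ d∈b) = d≢b (x∈⁅y⁆⇒x≡y b d∈b)
      d∉ d≢b d≢c (inj₂ d∈c) = d≢c (x∈⁅y⁆⇒x≡y c d∈c)
    a∉N : a ∉ₛ N ⊤ pair
    a∉N a∈ = a∉ (∈-N⁻ ⊤ pair a∈)
      where
      a∉ : ¬ (∃ λ e → e ∈ₛ ⊤ × α e ≡ a × β e ∈ₛ pair)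
      a∉ (e , _ , refl , βe∈) with x∈p∪q⁻ ⁅ b ⁆ _ βe∈
      ... | inj₁ βe∈b = a∉Nb (∈-N⁺ ⊤ ⁅ b ⁆ ∈⊤ βe∈b)
      ... | inj₂ βe∈c = a∉Nc (∈-N⁺ ⊤ ⁅ c ⁆ ∈⊤ βe∈c)

  module _ (b : Fin 3 → V) (b∈B : ∀ i → b i ∈ₛ B) (b-injective : ∀ {i j} → b i ≡ b j → i ≡ j) where

    private
      a : Fin 3 → V
      a i = proj₁ (missing (b∈B i))

      a∈A : ∀ i → a i ∈ₛ A
      a∈A i = proj₁ (proj₂ (missing (b∈B i)))

      a∉N : ∀ i → a i ∉ₛ N ⊤ ⁅ b i ⁆
      a∉N i = proj₂ (proj₂ (missing (b∈B i)))

      a-injective : ∀ {i j} → a i ≡ a j → i ≡ j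
      a-injective {i} {j} ai≡aj = decidable-stable (i ≟ j) λ i≢j →
        missing-distinct (a∈A i) (b∈B i) (b∈B j) (i≢j ∘ b-injective) (a∉N i)
          (subst (_∉ₛ N ⊤ ⁅ b j ⁆) (sym ai≡aj) (a∉N j))

      join : ∀ {i j} → i ≢ j → ∃ λ e → α e ≡ a i × β e ≡ b j
      join {i} {j} i≢j =
        let e , _ , αe≡ , βe∈ = ∈-N⁻ ⊤ ⁅ b j ⁆
              (missing-unique (b∈B j) (a∈A j) (a∈A i) (a∉N j) (i≢j ∘ a-injective))
        in  e , αe≡ , x∈⁅y⁆⇒x≡y (b j) βe∈

      -- The hexagon a₀ b₁ a₂ b₀ a₁ b₂.
      corner : Fin 6 → Fin 3 ⊎ Fin 3
      corner 0F = inj₁ 0F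
      corner 1F = inj₂ 1F
      corner 2F = inj₁ 2F
      corner 3F = inj₂ 0F
      corner 4F = inj₁ 1F
      corner 5F = inj₂ 2F

      -- Indices of the A-end and the B-end of the side from corner i to the next one.
      αi βi : Fin 6 → Fin 3
      αi 0F = 0F
      αi 1F = 2F
      αi 2F = 2F
      αi 3F = 1F
      αi 4F = 1F
      αi 5F = 0F
      βi 0F = 1F
      βi 1F = 1F
      βi 2F = 0F
      βi 3F = 0F
      βi 4F = 2F
      βi 5F = 2F

      corner-injective : ∀ i j → corner i ≡ corner j → i ≡ j
      corner-injective = from-yes (all? λ i → all? λ j →
        Sum.≡-dec _≟_ _≟_ (corner i) (corner j) →-dec (i ≟ j))

      αi≢βi : ∀ i → αi i ≢ βi i
      αi≢βi = from-yes (all? λ i → ¬? (αi i ≟ βi i))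

      αi-βi-injective : ∀ i j → αi i ≡ αi j → βi i ≡ βi j → i ≡ j
      αi-βi-injective = from-yes (all? λ i → all? λ j →
        (αi i ≟ αi j) →-dec ((βi i ≟ βi j) →-dec (i ≟ j)))

      vertexAt : Fin 3 ⊎ Fin 3 → V
      vertexAt (inj₁ i) = a i
      vertexAt (inj₂ i) = b i

      vertexAt-injective : ∀ {x y} → vertexAt x ≡ vertexAt y → x ≡ y
      vertexAt-injective {inj₁ i} {inj₁ j} eq = cong inj₁ (a-injective eq)
      vertexAt-injective {inj₁ i} {inj₂ j} eq = contradiction (subst (_∈ₛ B) (sym eq) (b∈B j)) (A-∉-B (a∈A i))
      vertexAt-injective {inj₂ i} {inj₁ j} eq = contradiction (subst (_∈ₛ B) eq (b∈B i)) (A-∉-B (a∈A j))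
      vertexAt-injective {inj₂ i} {inj₂ j} eq = cong inj₂ (b-injective eq)

      h : Fin 6 → E
      h i = proj₁ (join (αi≢βi i))

      h-α : ∀ i → α (h i) ≡ a (αi i)
      h-α i = proj₁ (proj₂ (join (αi≢βi i)))

      h-β : ∀ i → β (h i) ≡ b (βi i)
      h-β i = proj₂ (proj₂ (join (αi≢βi i)))

      h-injective : ∀ {i j} → h i ≡ h j → i ≡ j
      h-injective {i} {j} hi≡hj = αi-βi-injective i j
        (a-injective (trans (sym (h-α i)) (trans (cong α hi≡hj) (h-α j))))
        (b-injective (trans (sym (h-β i)) (trans (cong β hi≡hj) (h-β j))))

      h-joins : ∀ i → Joins G (h i) (a (αi i)) (b (βi i))
      h-joins i = subst₂ (Joins G (h i)) (h-α i) (h-β i) (joins (h i))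

      g : Fin 6 → V
      g i = vertexAt (corner i)

      g-joins : ∀ i → Joins G (h i) (g i) (g (suc (toℕ i) mod 6))
      g-joins 0F = h-joins 0F
      g-joins 1F = joins-sym (h-joins 1F)
      g-joins 2F = h-joins 2F
      g-joins 3F = joins-sym (h-joins 3F)
      g-joins 4F = h-joins 4F
      g-joins 5F = joins-sym (h-joins 5F)

    labelled⇒≅C₆ : G ≅ C₆
    labelled⇒≅C₆ = hexagon⇒≅C₆ G n≡6 m≡6 g h
      (λ {i} {j} eq → corner-injective i j (vertexAt-injective eq)) h-injective g-joins

  ≅C₆ : G ≅ C₆
  ≅C₆ =
    let x , x∈ = 0<∣p∣⇒Nonempty B (≤-trans (s≤s z≤n) 1<∣B∣)
        y , y∈ , y≢x = 1<∣p∣⇒another B 1<∣B∣ x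
        z , z∈ , z≢x , z≢y = 2<∣p∣⇒another B (≤-reflexive (sym ∣B∣≡3)) x y
    in  label x∈ y∈ z∈ y≢x z≢x z≢y
    where
    label : ∀ {x y z} → x ∈ₛ B → y ∈ₛ B → z ∈ₛ B → y ≢ x → z ≢ x → z ≢ y → G ≅ C₆
    label {x} {y} {z} x∈ y∈ z∈ y≢x z≢x z≢y = labelled⇒≅C₆ b b∈B b-injective
      where
      b : Fin 3 → V
      b 0F = x
      b 1F = y
      b 2F = z
      b∈B : ∀ i → b i ∈ₛ B
      b∈B 0F = x∈
      b∈B 1F = y∈
      b∈B 2F = z∈
      b-injective : ∀ {i j} → b i ≡ b j → i ≡ j
      b-injective {0F} {0F} _  = refl
      b-injective {0F} {1F} eq = contradiction (sym eq) y≢x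
      b-injective {0F} {2F} eq = contradiction (sym eq) z≢x
      b-injective {1F} {0F} eq = contradiction eq y≢x
      b-injective {1F} {1F} _  = refl
      b-injective {1F} {2F} eq = contradiction (sym eq) z≢y
      b-injective {2F} {0F} eq = contradiction eq z≢x
      b-injective {2F} {1F} eq = contradiction eq z≢y
      b-injective {2F} {2F} _  = refl

-- Vertices of degree two in an edge extremal graph

heavy-exists : (G : Graph) (side : Vertex G → Bool) →
  (∀ e → side (proj₁ (ends G e)) ≢ side (proj₂ (ends G e))) →
  MinimalMatchingCovered G → 2 * size G + 6 ≡ 3 * order G → ¬ G ≅ C₆ →
  ∃ λ v → side v ≡ true × 2 < degree G v
heavy-exists G side bipartite minimal extremal G≇C₆ =
  decidable-stable (any? λ v → (side v Bool.≟ true) ×-dec (2 ℕ.<? degree G v)) λ none →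
    let light : ∀ {v} → side v ≡ true → ¬ 2 < degree G v
        light = λ {v} v-true heavy → none (v , v-true , heavy)
        n≡6 , m≡6 = C.no-heavy⇒hexagonal λ v∈A → light (∈-subset⁻ C.onA? v∈A)
    -- The sides are exchanged because `Hexagonal` expects the vertices of degree two on its `false`
    -- side.
    in  G≇C₆ (Hexagonal.≅C₆ G (not ∘ side) (λ e → bipartite e ∘ Bool.not-injective)
               (proj₁ minimal) n≡6 m≡6 (λ v-false → light (Bool.not-injective v-false)))
  where module C = Counting G side bipartite minimal extremal

heavy-unique : (G : Graph) (side : Vertex G → Bool) →
  (∀ e → side (proj₁ (ends G e)) ≢ side (proj₂ (ends G e))) →
  MinimalMatchingCovered G → 2 * size G + 6 ≡ 3 * order G →
  ∀ {u v} → side u ≡ true → side v ≡ true → 2 < degree G u → 2 < degree G v → u ≡ v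
heavy-unique G side bipartite minimal extremal u-true v-true =
  C.heavy-unique (∈-subset⁺ C.onA? u-true) (∈-subset⁺ C.onA? v-true)
  where module C = Counting G side bipartite minimal extremal

-- The results on A, applied also with the sides exchanged, give exactly one heavy vertex on each
-- side. All others have degree two, as no degree is below two.
length-V₂ : (G : Graph) → MinimalBipartiteMatchingCovered G →
            2 * size G + 6 ≡ 3 * order G → ¬ G ≅ C₆ → length (V₂ G) + 2 ≡ order G
length-V₂ G ((side , bipartite) , minimal) extremal G≇C₆ =
  let a , a-true  , heavy-a = heavy-exists G side bipartite minimal extremal G≇C₆
      b , b-false , heavy-b = heavy-exists G (not ∘ side) bipartite′ minimal extremal G≇C₆
  in  count a-true heavy-a (Bool.not-injective b-false) heavy-b
  where
  open Covered G side bipartite (proj₁ minimal) using (1<degree-all)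
  bipartite′ : ∀ e → not (side (proj₁ (ends G e))) ≢ not (side (proj₂ (ends G e)))
  bipartite′ e = bipartite e ∘ Bool.not-injective

  degree-2? : ∀ v → Dec (degree G v ≡ 2)
  degree-2? v = degree G v ℕ.≟ 2

  count : ∀ {a b} → side a ≡ true → 2 < degree G a → side b ≡ false → 2 < degree G b →
          length (V₂ G) + 2 ≡ order G
  count {a} {b} a-true heavy-a b-false heavy-b = begin
    length (V₂ G) + 2            ≡⟨ +-comm (length (V₂ G)) 2 ⟩
    2 + length (V₂ G)            ≡⟨ cong (2 +_) (length-filter-allFin degree-2?) ⟩
    2 + ∣ subset degree-2? ∣     ≡⟨ cong (λ q → 2 + ∣ q ∣) subset≡ ⟩
    2 + ∣ ⊤ - a - b ∣            ≡⟨ cong suc (x∈p⇒1+∣p-x∣≡∣p∣ (⊤ - a) (x∈p∧x≢y⇒x∈p-y ∈⊤ b≢a)) ⟩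
    suc ∣ ⊤ - a ∣                ≡⟨ x∈p⇒1+∣p-x∣≡∣p∣ (⊤ {order G}) {a} ∈⊤ ⟩
    ∣ ⊤ {order G} ∣              ≡⟨ ∣⊤∣≡n (order G) ⟩
    order G                      ∎
    where
    open ≡-Reasoning
    b≢a : b ≢ a
    b≢a refl with () ← trans (sym a-true) b-false

    light : ∀ {v} → v ≢ a → v ≢ b → ¬ 2 < degree G v
    light {v} v≢a v≢b heavy with side v in v-side
    ... | true  = v≢a (heavy-unique G side bipartite minimal extremal v-side a-true heavy heavy-a)
    ... | false = v≢b (heavy-unique G (not ∘ side) bipartite′ minimal extremal
                    (cong not v-side) (cong not b-false) heavy heavy-b)

    subset≡ : subset degree-2? ≡ ⊤ - a - b
    subset≡ = ⊆-antisym
      (λ v∈ → x∈p∧x≢y⇒x∈p-y (x∈p∧x≢y⇒x∈p-y ∈⊤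
        (λ { refl → <⇒≢ heavy-a (sym (∈-subset⁻ degree-2? v∈)) }))
        (λ { refl → <⇒≢ heavy-b (sym (∈-subset⁻ degree-2? v∈)) }))
      (λ v∈ → ∈-subset⁺ degree-2? (≤-antisym
        (≮⇒≥ (light (x∈p-y⇒x≢y ⊤ (x∈p-y⇒x∈p (⊤ - a) v∈)) (x∈p-y⇒x≢y (⊤ - a) v∈)))
        (1<degree-all _)))

-- Passing between integers and natural numbers

edgeExtremal⇒ℕ : ∀ G → EdgeExtremal G → 2 * size G + 6 ≡ 3 * order G
edgeExtremal⇒ℕ G extremal = ℤ.+-injective (begin
  ℤ.+ (2 * size G + 6)                     ≡⟨ ℤ.pos-+ (2 * size G) 6 ⟩
  ℤ.+ (2 * size G) ℤ.+ ℤ.+ 6               ≡⟨ cong (ℤ._+ ℤ.+ 6) (trans (ℤ.pos-* 2 (size G)) extremal) ⟩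
  ℤ.+ 3 ℤ.* ℤ.+ order G ℤ.- ℤ.+ 6 ℤ.+ ℤ.+ 6 ≡⟨ solve 1 (λ n → n :- con (ℤ.+ 6) :+ con (ℤ.+ 6) := n)
                                               refl (ℤ.+ 3 ℤ.* ℤ.+ order G) ⟩
  ℤ.+ 3 ℤ.* ℤ.+ order G                    ≡⟨ ℤ.pos-* 3 (order G) ⟨
  ℤ.+ (3 * order G)                        ∎)
  where
  open ≡-Reasoning
  open ℤ.+-*-Solver

-- With 2m = 3n - 6, the value 2(m - n + 2) becomes n - 2.
twoVertexExtremal⇐ : ∀ G → EdgeExtremal G → length (V₂ G) + 2 ≡ order G → TwoVertexExtremal G
twoVertexExtremal⇐ G extremal l+2≡n = sym (begin
  two ℤ.* (mᶻ ℤ.- nᶻ ℤ.+ two)                        ≡⟨ solve 2 (λ x y →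
    con two :* (x :- y :+ con two) := con two :* x :- con two :* y :+ con (ℤ.+ 4)) refl mᶻ nᶻ ⟩
  two ℤ.* mᶻ ℤ.- two ℤ.* nᶻ ℤ.+ ℤ.+ 4                ≡⟨ cong (λ k → k ℤ.- two ℤ.* nᶻ ℤ.+ ℤ.+ 4) extremal ⟩
  ℤ.+ 3 ℤ.* nᶻ ℤ.- ℤ.+ 6 ℤ.- two ℤ.* nᶻ ℤ.+ ℤ.+ 4    ≡⟨ cong (λ k → ℤ.+ 3 ℤ.* k ℤ.- ℤ.+ 6 ℤ.- two ℤ.* k ℤ.+ ℤ.+ 4) nᶻ≡ ⟩
  ℤ.+ 3 ℤ.* (lᶻ ℤ.+ two) ℤ.- ℤ.+ 6 ℤ.- two ℤ.* (lᶻ ℤ.+ two) ℤ.+ ℤ.+ 4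
    ≡⟨ solve 1 (λ x →
         con (ℤ.+ 3) :* (x :+ con two) :- con (ℤ.+ 6) :- con two :* (x :+ con two) :+ con (ℤ.+ 4) := x) refl lᶻ ⟩
  lᶻ                                                ∎)
  where
  open ≡-Reasoning
  open ℤ.+-*-Solver
  two lᶻ mᶻ nᶻ : ℤ.ℤ
  two = ℤ.+ 2
  lᶻ = ℤ.+ length (V₂ G)
  mᶻ = ℤ.+ size G
  nᶻ = ℤ.+ order G
  nᶻ≡ : nᶻ ≡ lᶻ ℤ.+ two
  nᶻ≡ = trans (cong ℤ.+_ (sym l+2≡n)) (ℤ.pos-+ (length (V₂ G)) 2)

-- The 4-cycle

perfectMatching? : ∀ G M → Dec (PerfectMatching G M)
perfectMatching? G M = all? λ v → any? λ e →
  matches? v e ×-dec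
  -- The competing edge is an implicit argument in `∃!` but an explicit one in `all?`.
  map′ (λ unique {f} → unique f) (λ unique f → unique {f}) (all? λ f → matches? v f →-dec (e ≟ f))
  where
  matches? : ∀ v e → Dec (e ∈ₛ M × Incident G v e)
  matches? v e = (e ∈? M) ×-dec incident? G v e

C₄ : Graph
C₄ = graph 4 4 ends₄ (from-yes (all? λ e → ¬? (proj₁ (ends₄ e) ≟ proj₂ (ends₄ e))))
  where
  ends₄ : Fin 4 → Fin 4 × Fin 4
  ends₄ i = i , suc (toℕ i) mod 4

C₄-bipartite : Bipartite C₄
C₄-bipartite = side , from-yes (all? λ e → ¬? (side (proj₁ (ends C₄ e)) Bool.≟ side (proj₂ (ends C₄ e))))
  where
  side : Fin 4 → Bool
  side 0F = true
  side 1F = false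
  side 2F = true
  side 3F = false

C₄-connected : Connected C₄
C₄-connected u v = to-0 u ◅◅ Star.reverse adjacent-sym (to-0 v)
  where
  adjacent-sym : ∀ {u v} → Adjacent C₄ u v → Adjacent C₄ v u
  adjacent-sym (e , inj₁ p) = e , inj₂ p
  adjacent-sym (e , inj₂ p) = e , inj₁ p
  to-0 : ∀ v → Star (Adjacent C₄) v 0F
  to-0 0F = ε
  to-0 1F = (0F , inj₂ refl) ◅ ε
  to-0 2F = (1F , inj₂ refl) ◅ to-0 1F
  to-0 3F = (3F , inj₁ refl) ◅ ε

C₄-covered : MatchingCovered C₄
C₄-covered = ≤-refl , C₄-connected , λ where
    0F → even , even-perfect , here
    1F → odd  , odd-perfect  , there here
    2F → even , even-perfect , there (there here)
    3F → odd  , odd-perfect  , there (there (there here))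
  where
  even odd : Subset 4
  even = true ∷ false ∷ true ∷ false ∷ []
  odd  = false ∷ true ∷ false ∷ true ∷ []
  even-perfect : PerfectMatching C₄ even
  even-perfect = from-yes (perfectMatching? C₄ even)
  odd-perfect : PerfectMatching C₄ odd
  odd-perfect = from-yes (perfectMatching? C₄ odd)

-- Deleting e leaves its ends with degree one, whereas a bipartite matching covered graph has all
-- degrees at least two.
C₄-minimal : ∀ e → ¬ MatchingCovered (C₄ -ₑ e)
C₄-minimal e covered = <⇒≱ (1<degree-all (proj₁ (ends C₄ e))) (leaf e)
  where
  open Covered (C₄ -ₑ e) (proj₁ C₄-bipartite) (proj₂ C₄-bipartite ∘ punchIn e) covered
  leaf : ∀ e → degree (C₄ -ₑ e) (proj₁ (ends C₄ e)) ≤ 1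
  leaf = from-yes (all? λ e → degree (C₄ -ₑ e) (proj₁ (ends C₄ e)) ℕ.≤? 1)

corollary7p4 : (H₄ ∖ (_≅ C₆)) ⊆ H₂ × (∃ λ G → G ∈ H₂ × G ∉ (H₄ ∖ (_≅ C₆)))
corollary7p4 =
  (λ {G} ((minimal , extremal) , G≇C₆) →
    minimal , twoVertexExtremal⇐ G extremal (length-V₂ G minimal (edgeExtremal⇒ℕ G extremal) G≇C₆)) ,
  -- Here m = n = 4: all four vertices have degree two and 2(m - n + 2) = 4, but edge extremality
  -- would read 8 = 6.
  C₄ , ((C₄-bipartite , C₄-covered , C₄-minimal) , refl) , λ { ((_ , ()) , _) }
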